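{- Let $\beta=\mathrm{LB}\circ\mathrm{compl}\circ\mathrm{LB}$ on Tamari intervals (interval-posets). Then $\beta$ is an involution on Tamari intervals such that for every interval $I$ and every commutative alphabet $X$: $\mathrm{rises}(I)=\mathrm{contacts}(\beta(I))$, $\mathrm{RiseMon}(I,X)=\mathrm{ContactMon}(\beta(I),X)$, and $\mathrm{dist}(I)=\mathrm{dist}(\beta(I))$.
   Context: Interval-posets: a partial order $\triangleleft$ on $\{1,\dots,n\}$ such that for all $a<b<c$, $a\triangleleft c\Rightarrow b\triangleleft c$ and $c\triangleleft a\Rightarrow b\triangleleft a$. Relations $x\triangleleft y$ with $x<y$ are increasing, with $x>y$ decreasing. The decreasing children of $b$ are the $c>b$ with $c\triangleleft b$ a cover relation of the poset of decreasing relations. Binary tree nodes $v_1,\dots,v_n$ are numbered in in-order. Dyck paths (words in up-step $1$ / down-step $0$) correspond to binary trees via $\mathrm{tree}(D_1 1 D_2 0)=$ tree with left subtree $\mathrm{tree}(D_1)$, right subtree $\mathrm{tree}(D_2)$. The Tamari order is generated by right rotations $y(x(A,B),C)\to x(A,y(B,C))$. A Tamari interval $[T_1,T_2]$ ($T_1\le T_2$) is identified with the interval-poset where, for $a<b$, $b\triangleleft a$ iff $v_b$ is in the right subtree of $v_a$ in $T_1$, and $a\triangleleft b$ iff $v_a$ is in the left subtree of $v_b$ in $T_2$; lower/upper bound Dyck paths $D_1,D_2$ satisfy $\mathrm{tree}(D_i)=T_i$. Statistics: for a Dyck path $D$ of size $n$, $\mathrm{contacts}(D)$ = number of points at height $0$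 except the last; $\mathrm{rises}(D)$ = initial run of up-steps; $\mathrm{contacts}_i(D)$ = number of non-final contacts of the Dyck subpath strictly between the $i$-th up-step and its matching down-step; $\mathrm{rises}_i(D)$ = number of up-steps immediately after the $i$-th down-step. $\mathrm{ContactMon}(D,X)=x_{\mathrm{contacts}(D)}\prod_{i=1}^{n-1}x_{\mathrm{contacts}_i(D)}$, $\mathrm{RiseMon}(D,X)=x_{\mathrm{rises}(D)}\prod_{i=1}^{n-1}x_{\mathrm{rises}_i(D)}$. For $I=[D_1,D_2]$, contact statistics are taken on $D_1$ and rise statistics on $D_2$. $\mathrm{dist}(I)$ is the maximal length of a chain from $D_1$ to $D_2$ in the Tamari lattice. Grafting: $u$ is the interval-poset of size $1$. For interval-posets $I_1,I_2$ of sizes $n_1,n_2$, the shifted concatenation is the poset on $\{1,\dots,n_1+n_2\}$ with the relations of $I_1$ and those of $I_2$ shifted by $n_1$. For $n_2>0$, $I_1\prec I_2$ (left grafting) is the shifted concatenation plus the relations $y\triangleleft n_1+1$ for all $y\le n_1$; by convention $\emptyset\prec I_2=I_2$. For $n_1>0$ and $0\le r\le c$, where $y_1<\dots<y_c$ are the (shifted) decreasing roots of $I_2$ (vertices with no smaller vertex above them), $I_1\succ_r I_2$ (right grafting) is the shifted concatenation plus $y_i\triangleleft n_1$ for $1\le i\le r$; by convention $I_1\succ_0\emptyset=I_1$. A grafting tree is a binary tree $T$ with labeling $\ell$ of its nodes by nonnegative integers such that for every node $v$, $\ell(v)\le \mathrm{size}(T_R(v))-\sum_{w\in T_R(v)}\ell(w)$,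 $T_R(v)$ the right subtree. Define $\mathrm{Graft}^{ -1}(\emptyset)=\emptyset$ and, for $T$ with root $v$, left subtree $T_L$, right subtree $T_R$, $\mathrm{Graft}^{ -1}(T,\ell)=\mathrm{Graft}^{ -1}(T_L,\ell)\prec\big(u\succ_{\ell(v)}\mathrm{Graft}^{ -1}(T_R,\ell)\big)$; this is a bijection from grafting trees to interval-posets, with inverse $\mathrm{Graft}$. Left branch involution on binary trees: $\mathrm{LB}(\emptyset)=\emptyset$; if $T$ has root $v$, left subtree $T_L$, right subtree $T_R$, then $\mathrm{LB}(T)$ is obtained from $\mathrm{LB}(T_L)$ by attaching, as left child of the leftmost node of $\mathrm{LB}(T_L)$ (or as the whole tree if $\mathrm{LB}(T_L)$ is empty), the node $v$ with empty left subtree and right subtree $\mathrm{LB}(T_R)$. On a grafting tree, nodes carry their labels; the result is again a grafting tree. On intervals, $\mathrm{LB}(I)=\mathrm{Graft}^{ -1}(\mathrm{LB}(\mathrm{Graft}(I)))$. The complement $\mathrm{compl}(I)$ of an interval-poset of size $n$ is defined by $i\triangleleft_{\mathrm{compl}(I)}j$ iff $(n+1-i)\triangleleft_I(n+1-j)$. -}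

module Defs where

open import Data.Nat using (ℕ; zero; suc; _+_; _∸_; _≤_; _<_)
open import Data.Bool using (Bool; true; false)
open import Data.List using (List; []; _∷_; _++_; map; foldr; upTo)
open import Data.Product using (Σ; _×_; _,_)
open import Data.Sum using (_⊎_)
open import Data.Unit using (⊤)
open import Data.Empty using (⊥)
open import Level using (0ℓ)
open import Relation.Nullary using (¬_)
open import Relation.Binary.PropositionalEquality using (_≡_; _≢_)
open import Relation.Binary.Construct.Closure.ReflexiveTransitive using (Star)
open import Relation.Binary.Construct.Closure.Transitive using (TransClosure)
open import Algebra.Bundles using (CommutativeMonoid)

data Tree : Set where
  leaf : Tree
  node : Tree → Tree → Tree

size : Tree → ℕ
size leaf = 0
size (node L R) = suc (size L + size R)

data Rot : Tree → Tree → Set where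
  rot : ∀ {A B C} → Rot (node (node A B) C) (node A (node B C))
  inL : ∀ {L L' R} → Rot L L' → Rot (node L R) (node L' R)
  inR : ∀ {L R R'} → Rot R R' → Rot (node L R) (node L R')

_≤T_ : Tree → Tree → Set
_≤T_ = Star Rot

_<T_ : Tree → Tree → Set
A <T B = (A ≤T B) × (A ≢ B)

data Chain : ℕ → Tree → Tree → Set where
  nil  : ∀ {A} → Chain 0 A A
  cons : ∀ {k A B C} → A <T B → Chain k B C → Chain (suc k) A C

IsDist : Tree → Tree → ℕ → Set
IsDist A B d = Chain d A B × (∀ k → Chain k A B → k ≤ d)

record Interval : Set where
  constructor interval
  field
    lower : Tree
    upper : Tree
    le    : lower ≤T upper
open Interval public

-- Dyck paths (true = up-step 1, false = down-step 0)

-- tree (D₁ 1 D₂ 0) = node (tree D₁) (tree D₂); dyck is its inverse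
dyck : Tree → List Bool
dyck leaf = []
dyck (node L R) = dyck L ++ (true ∷ dyck R ++ (false ∷ []))

numUps : List Bool → ℕ
numUps [] = 0
numUps (true ∷ w) = suc (numUps w)
numUps (false ∷ w) = numUps w

-- number of points at height 0 except the last one, starting at height h
contactsFrom : ℕ → List Bool → ℕ
contactsFrom zero (true ∷ w) = suc (contactsFrom 1 w)
contactsFrom zero (false ∷ w) = suc (contactsFrom 0 w)
contactsFrom (suc h) (true ∷ w) = contactsFrom (suc (suc h)) w
contactsFrom (suc h) (false ∷ w) = contactsFrom h w
contactsFrom _ [] = 0

contacts : List Bool → ℕ
contacts = contactsFrom 0

rises : List Bool → ℕ
rises (true ∷ w) = suc (rises w)
rises _ = 0

dropUp : ℕ → List Bool → List Bool
dropUp _ [] = []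
dropUp k (false ∷ w) = dropUp k w
dropUp zero (true ∷ w) = w
dropUp (suc k) (true ∷ w) = dropUp k w

dropDown : ℕ → List Bool → List Bool
dropDown _ [] = []
dropDown k (true ∷ w) = dropDown k w
dropDown zero (false ∷ w) = w
dropDown (suc k) (false ∷ w) = dropDown k w

takeBal : ℕ → List Bool → List Bool
takeBal _ [] = []
takeBal h (true ∷ w) = true ∷ takeBal (suc h) w
takeBal zero (false ∷ w) = []
takeBal (suc h) (false ∷ w) = false ∷ takeBal h w

-- contacts_i(D), i ≥ 1: contacts of the subpath strictly between the
-- i-th up-step and its matching down-step
contactsAt : ℕ → List Bool → ℕ
contactsAt i D = contacts (takeBal 0 (dropUp (i ∸ 1) D))

-- rises_i(D), i ≥ 1: number of up-steps right after the i-th down-step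
risesAt : ℕ → List Bool → ℕ
risesAt i D = rises (dropDown (i ∸ 1) D)

oneTo : ℕ → List ℕ
oneTo m = map suc (upTo m)

module _ (M : CommutativeMonoid 0ℓ 0ℓ) where
  open CommutativeMonoid M

  prodM : List Carrier → Carrier
  prodM = foldr _∙_ ε

  ContactMon : (ℕ → Carrier) → List Bool → Carrier
  ContactMon x D =
    x (contacts D) ∙ prodM (map (λ i → x (contactsAt i D)) (oneTo (numUps D ∸ 1)))

  RiseMon : (ℕ → Carrier) → List Bool → Carrier
  RiseMon x D =
    x (rises D) ∙ prodM (map (λ i → x (risesAt i D)) (oneTo (numUps D ∸ 1)))

-- Interval-posets (relations on {1,…,n}, all relations inside the range)

Rel₂ : Set₁
Rel₂ = ℕ → ℕ → Set

record IPos : Set₁ where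
  field
    sz  : ℕ
    rel : Rel₂
open IPos public

_≋_ : IPos → IPos → Set
P ≋ Q = (sz P ≡ sz Q) × (∀ i j → (rel P i j → rel Q i j) × (rel Q i j → rel P i j))

-- InL T a b : v_a is in the left subtree of v_b  (in-order numbering from 1)
data InL : Tree → ℕ → ℕ → Set where
  here  : ∀ {L R a} → 1 ≤ a → a ≤ size L → InL (node L R) a (suc (size L))
  left  : ∀ {L R a b} → InL L a b → InL (node L R) a b
  right : ∀ {L R a b} → InL R a b →
          InL (node L R) (suc (size L) + a) (suc (size L) + b)

-- InR T a b : v_b is in the right subtree of v_a
data InR : Tree → ℕ → ℕ → Set where
  here  : ∀ {L R b} → suc (size L) < b → b ≤ suc (size L) + size R →
          InR (node L R) (suc (size L)) b
  left  : ∀ {L R a b} → InR L a b → InR (node L R) a b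
  right : ∀ {L R a b} → InR R a b →
          InR (node L R) (suc (size L) + a) (suc (size L) + b)

ipos : Interval → IPos
ipos I = record
  { sz  = size (lower I)
  ; rel = λ a b → (1 ≤ a × a ≤ size (lower I) × a ≡ b)
                  ⊎ InL (upper I) a b        -- increasing a ◁ b (a < b)
                  ⊎ InR (lower I) b a        -- decreasing a ◁ b (a > b)
  }

emptyP : IPos
emptyP = record { sz = 0 ; rel = λ _ _ → ⊥ }

uP : IPos
uP = record { sz = 1 ; rel = λ a b → (a ≡ 1) × (b ≡ 1) }

concatRel : IPos → IPos → Rel₂
concatRel I J a b =
  (a ≤ sz I × b ≤ sz I × rel I a b)
  ⊎ Σ ℕ (λ c → Σ ℕ (λ d → (a ≡ sz I + c) × (b ≡ sz I + d) × rel J c d))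

leftGraftAux : ℕ → IPos → IPos → IPos
leftGraftAux zero I J = J
leftGraftAux (suc _) I J = record
  { sz  = sz I + sz J
  ; rel = TransClosure (λ a b → concatRel I J a b
                                 ⊎ (1 ≤ a × a ≤ sz I × b ≡ suc (sz I)))
  }

leftGraft : IPos → IPos → IPos
leftGraft I J = leftGraftAux (sz I) I J

DecRoot : IPos → ℕ → Set
DecRoot J y = (1 ≤ y) × (y ≤ sz J) × (∀ x → x < y → ¬ rel J y x)

data CountUpTo (P : ℕ → Set) : ℕ → ℕ → Set where
  c0   : CountUpTo P 0 0
  cyes : ∀ {y k} → P (suc y) → CountUpTo P y k → CountUpTo P (suc y) (suc k)
  cno  : ∀ {y k} → ¬ P (suc y) → CountUpTo P y k → CountUpTo P (suc y) k

-- right grafting I ≻_r J : add y_i ◁ n₁ for the first r decreasing roots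
-- y_1 < … < y_r of J (shifted), poset generated
rightGraft : IPos → ℕ → IPos → IPos
rightGraft I r J = record
  { sz  = sz I + sz J
  ; rel = TransClosure (λ a b → concatRel I J a b
            ⊎ Σ ℕ (λ y → Σ ℕ (λ k → (a ≡ sz I + y) × (b ≡ sz I)
                   × DecRoot J y × CountUpTo (DecRoot J) y k × (k ≤ r))))
  }

compl : IPos → IPos
compl P = record
  { sz  = sz P
  ; rel = λ i j → rel P (suc (sz P) ∸ i) (suc (sz P) ∸ j) }

data GTree : Set where
  gleaf : GTree
  gnode : GTree → ℕ → GTree → GTree

gsize : GTree → ℕ
gsize gleaf = 0
gsize (gnode L _ R) = suc (gsize L + gsize R)

labelSum : GTree → ℕ
labelSum gleaf = 0
labelSum (gnode L l R) = labelSum L + l + labelSum R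

Valid : GTree → Set
Valid gleaf = ⊤
Valid (gnode L l R) = Valid L × Valid R × (l + labelSum R ≤ gsize R)

graftInv : GTree → IPos
graftInv gleaf = emptyP
graftInv (gnode L l R) = leftGraft (graftInv L) (rightGraft uP l (graftInv R))

attachLeftmost : GTree → GTree → GTree
attachLeftmost gleaf t = t
attachLeftmost (gnode A m B) t = gnode (attachLeftmost A t) m B

LB : GTree → GTree
LB gleaf = gleaf
LB (gnode L l R) = attachLeftmost (LB L) (gnode gleaf l (LB R))

-- β = LB ∘ compl ∘ LB, with LB(I) = Graft⁻¹(LB(Graft I)) and Graft the
-- inverse of Graft⁻¹, expressed as a relation:  BetaRel I J  iff  J = β(I)

BetaRel : Interval → Interval → Set
BetaRel I J =
  Σ GTree λ G → Σ GTree λ G' →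
    Valid G × Valid G'
    × (ipos I ≋ graftInv G)                        -- G  = Graft(I)
    × (graftInv G' ≋ compl (graftInv (LB G)))     -- G' = Graft(compl(LB(I)))
    × (ipos J ≋ graftInv (LB G'))

{-# OPTIONS --safe #-}

-- Read a binary tree as a forest along its left branch.  A grafting tree is
-- then the same thing as a pair lower ≤ upper: the upper tree is its skeleton,
-- and in the lower tree a node with label l adopts the first l roots of the
-- lower forest of its right subtree.  Each root that is not adopted (they are
-- counted by the slack) costs one rotation, so the distance is the total slack,
-- which LB preserves.  LB also preserves the multiset of labels, and these are
-- the numbers contactsᵢ of the lower tree.  The complement exchanges the two
-- trees and mirrors them; this reverses the Tamari order, hence preserves the
-- distance.  Finally, the rises of T and the contacts of mirror (LB T) satisfy
-- the same recursion.
module Submission where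

open import Defs
open import Data.Nat
open import Data.Nat.Properties
open import Data.Nat.Tactic.RingSolver using (solve-∀)
open import Data.Bool using (Bool; true; false)
open import Data.Empty using (⊥-elim)
open import Data.List using (List; []; _∷_; _++_; [_]; map; applyUpTo; upTo; take; length)
open import Data.List.Properties using (++-assoc; ++-identityʳ; map-applyUpTo; map-∘; length-++; ∷-injectiveˡ)
open import Data.List.Relation.Binary.Permutation.Propositional as Perm using (_↭_; prep; swap; ↭-refl; ↭-sym; ↭-trans; ↭-reflexive)
open import Data.List.Relation.Binary.Permutation.Propositional.Properties using (++⁺; ++⁺ˡ; ++⁺ʳ; ++-comm; drop-∷; ∷↭∷ʳ)
open import Data.Product using (Σ; _×_; _,_; proj₁; proj₂)
open import Data.Sum using (_⊎_; inj₁; inj₂)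
open import Data.Unit using (tt)
open import Function using (_∘_; id)
open import Level using (0ℓ)
open import Relation.Nullary using (¬_; yes; no)
open import Relation.Binary.Definitions using (tri<; tri≈; tri>)
open import Relation.Binary.PropositionalEquality hiding ([_])
open import Relation.Binary.Construct.Closure.ReflexiveTransitive using (ε; _◅_; _◅◅_; gmap)
open import Relation.Binary.Construct.Closure.Transitive using (TransClosure; _∷_) renaming ([_] to [_]⁺)
open import Algebra.Bundles using (CommutativeMonoid)

-- The obstacle is the complement: it acts on the pair of trees, and its effect on labels is not
-- explicit. The slack of `G'` therefore cannot be compared with that of `LB G` node by node. It is
-- recognised instead as an invariant of the pair, the distance. One direction is an explicit chain
-- of rotations. For the bound, start from the interval from `T` to `T`, whose grafting tree has
-- slack 0, and walk down: each rotation of the lower tree strictly raises the total slack of a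
-- grafting tree with upper tree `T`. Since a pair has only one grafting tree, no chain is longer
-- than its slack. The same walk shows that every interval has a grafting tree.
--
-- The second obstacle is that β is defined through posets generated by transitive closure. The
-- relations of a pair with lower ≤ upper are already transitive, so the closure adds nothing to
-- them, and they determine both trees. From there on only trees are handled.

-- Forests along the left branch

infixl 6 _⊕_
-- Concatenation of forests: in in-order the nodes of `A` come first, and the labels of `B` are
-- shifted by `size A`.
_⊕_ : Tree → Tree → Tree
A ⊕ leaf = A
A ⊕ node L R = node (A ⊕ L) R

roots : Tree → ℕ
roots leaf = 0
roots (node L R) = suc (roots L)

mirror : Tree → Tree
mirror leaf = leaf
mirror (node L R) = node (mirror R) (mirror L)

-- hang A k B has the decreasing forest of A followed by a new root, which
-- receives all the roots of B as children except the last k, followed by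
-- these k roots.
hang : Tree → ℕ → Tree → Tree
hang A zero B = node A B
hang A (suc k) leaf = node A leaf
hang A (suc k) (node B C) = node (hang A k B) C

size-⊕ : ∀ A B → size (A ⊕ B) ≡ size A + size B
size-⊕ A leaf = sym (+-identityʳ _)
size-⊕ A (node L R) rewrite size-⊕ A L = lem (size A) (size L) (size R)
  where
  lem : ∀ a l r → suc (a + l + r) ≡ a + suc (l + r)
  lem = solve-∀

⊕-identityˡ : ∀ A → leaf ⊕ A ≡ A
⊕-identityˡ leaf = refl
⊕-identityˡ (node L R) = cong (λ L → node L R) (⊕-identityˡ L)

-- The clause `hang A (suc k) leaf` is a default value outside the range `k ≤ roots B`, chosen so
-- that the size is still right.
size-hang : ∀ A k B → size (hang A k B) ≡ suc (size A + size B)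
size-hang A zero B = refl
size-hang A (suc k) leaf = refl
size-hang A (suc k) (node B C) rewrite size-hang A k B = lem (size A) (size B) (size C)
  where
  lem : ∀ a b c → suc (suc (a + b) + c) ≡ suc (a + suc (b + c))
  lem = solve-∀

roots-hang : ∀ A k B → k ≤ roots B → roots (hang A k B) ≡ suc (roots A + k)
roots-hang A zero B z≤n = cong suc (sym (+-identityʳ _))
roots-hang A (suc k) (node B C) (s≤s h) rewrite roots-hang A k B h = cong suc (sym (+-suc _ _))

hang-⊕ : ∀ A k B → hang A k B ≡ A ⊕ hang leaf k B
hang-⊕ A zero B = refl
hang-⊕ A (suc k) leaf = refl
hang-⊕ A (suc k) (node B C) = cong (λ L → node L C) (hang-⊕ A k B)

-- `X` is the adopted part of the forest and `Y` the part left over. This replaces the recursion on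
-- `k` by a concatenation, to which the facts about `_⊕_` apply.
hang-split : ∀ k B → k ≤ roots B → Σ Tree λ X → Σ Tree λ Y →
  (B ≡ X ⊕ Y) × (roots X + k ≡ roots B) × (∀ A → hang A k B ≡ node A X ⊕ Y)
hang-split zero B z≤n = B , leaf , refl , +-identityʳ _ , λ A → refl
hang-split (suc k) (node B C) (s≤s h) with hang-split k B h
... | X , Y , eq , r , e = X , node Y C , cong (λ L → node L C) eq
    , trans (+-suc _ _) (cong suc r) , λ A → cong (λ L → node L C) (e A)

-- Left subtrees grow strictly along the left branch from bottom to top, so the new root is the only
-- node there whose left subtree has size `size A`. Its depth is `k`.
hang-injective : ∀ {A A' B B'} k k' → size A ≡ size A' → k ≤ roots B → k' ≤ roots B' →
  hang A k B ≡ hang A' k' B' → (A ≡ A') × (k ≡ k') × (B ≡ B')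
hang-injective zero zero s h h' refl = refl , refl , refl
hang-injective {A' = A'} {B' = node B' C'} zero (suc k') s h h' refl =
  ⊥-elim (m≢1+m+n (size A') (trans (sym s) (size-hang A' k' B')))
hang-injective {A = A} {B = node B C} (suc k) zero s h h' refl =
  ⊥-elim (m≢1+m+n (size A) (trans s (size-hang A k B)))
hang-injective {A} {A'} {node B C} {node B' C'} (suc k) (suc k') s (s≤s h) (s≤s h') e
  with node-injective e
  where
  node-injective : ∀ {L R L' R'} → node L R ≡ node L' R' → (L ≡ L') × (R ≡ R')
  node-injective refl = refl , refl
... | e₁ , refl with hang-injective k k' s h h' e₁
... | refl , refl , refl = refl , refl , refl

mirror-involutive : ∀ T → mirror (mirror T) ≡ T
mirror-involutive leaf = refl
mirror-involutive (node L R) = cong₂ node (mirror-involutive L) (mirror-involutive R)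

mirror-injective : ∀ {S T} → mirror S ≡ mirror T → S ≡ T
mirror-injective {S} {T} e = trans (sym (mirror-involutive S)) (trans (cong mirror e) (mirror-involutive T))

size-mirror : ∀ T → size (mirror T) ≡ size T
size-mirror leaf = refl
size-mirror (node L R) rewrite size-mirror L | size-mirror R = cong suc (+-comm (size R) (size L))

-- The Tamari order

size-Rot : ∀ {S T} → Rot S T → size S ≡ size T
size-Rot (rot {A} {B} {C}) = lem (size A) (size B) (size C)
  where
  lem : ∀ a b c → suc (suc (a + b) + c) ≡ suc (a + suc (b + c))
  lem = solve-∀
size-Rot (inL {R = R} r) = cong (λ n → suc (n + size R)) (size-Rot r)
size-Rot (inR {L = L} r) = cong (λ n → suc (size L + n)) (size-Rot r)

size-≤T : ∀ {S T} → S ≤T T → size S ≡ size T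
size-≤T ε = refl
size-≤T (r ◅ p) = trans (size-Rot r) (size-≤T p)

mirror-Rot : ∀ {S T} → Rot S T → Rot (mirror T) (mirror S)
mirror-Rot rot = rot
mirror-Rot (inL r) = inR (mirror-Rot r)
mirror-Rot (inR r) = inL (mirror-Rot r)

mirror-≤T : ∀ {S T} → S ≤T T → mirror T ≤T mirror S
mirror-≤T ε = ε
mirror-≤T (r ◅ p) = mirror-≤T p ◅◅ (mirror-Rot r ◅ ε)

Rot-irrefl : ∀ {S T} → Rot S T → S ≢ T
Rot-irrefl rot ()
Rot-irrefl (inL r) refl = Rot-irrefl r refl
Rot-irrefl (inR r) refl = Rot-irrefl r refl

Rot⇒<T : ∀ {S T} → Rot S T → S <T T
Rot⇒<T r = (r ◅ ε) , Rot-irrefl r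

node-mono : ∀ {L L' R R'} → L ≤T L' → R ≤T R' → node L R ≤T node L' R'
node-mono p q = gmap _ inL p ◅◅ gmap _ inR q

_++C_ : ∀ {k m A B C} → Chain k A B → Chain m B C → Chain (k + m) A C
nil ++C d = d
cons p c ++C d = cons p (c ++C d)

mirror-<T : ∀ {S T} → S <T T → mirror T <T mirror S
mirror-<T (p , n) = mirror-≤T p , λ e → n (sym (mirror-injective e))

mirror-Chain : ∀ {k S T} → Chain k S T → Chain k (mirror T) (mirror S)
mirror-Chain nil = nil
mirror-Chain {T = T} (cons {k} {S} p c) =
  subst (λ k → Chain k (mirror T) (mirror S)) (+-comm k 1) (mirror-Chain c ++C cons (mirror-<T p) nil)

map-Chain : ∀ {k S T} (f : Tree → Tree) → (∀ {A B} → A <T B → f A <T f B) →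
  Chain k S T → Chain k (f S) (f T)
map-Chain f h nil = nil
map-Chain f h (cons p c) = cons (h p) (map-Chain f h c)

node-Chain : ∀ {k m L L' R R'} → Chain k L L' → Chain m R R' → Chain (k + m) (node L R) (node L' R')
node-Chain {L' = L'} {R = R} c d =
  map-Chain (λ L → node L R) (λ (p , n) → gmap _ inL p , λ { refl → n refl }) c
  ++C map-Chain (node L') (λ (p , n) → gmap _ inR p , λ { refl → n refl }) d

-- The leftover roots are adopted from the bottom of the left branch upwards, one rotation for each.
hang-Chain : ∀ A k B → k ≤ roots B → Chain k (hang A k B) (node A B)
hang-Chain A zero B h = nil
hang-Chain A (suc k) (node B C) (s≤s h) =
  subst (λ m → Chain m (hang A (suc k) (node B C)) (node A (node B C))) (lem k)
    (node-Chain (hang-Chain A k B h) nil ++C cons (Rot⇒<T rot) nil)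
  where
  lem : ∀ k → k + 0 + 1 ≡ suc k
  lem = solve-∀

Chain⇒≤T : ∀ {k A B} → Chain k A B → A ≤T B
Chain⇒≤T nil = ε
Chain⇒≤T (cons (p , _) c) = p ◅◅ Chain⇒≤T c

IsDist-unique : ∀ {A B d e} → IsDist A B d → IsDist A B e → d ≡ e
IsDist-unique (c , m) (c' , m') = ≤-antisym (m' _ c) (m _ c')

IsDist-mirror : ∀ {A B d} → IsDist A B d → IsDist (mirror B) (mirror A) d
IsDist-mirror {A} {B} (c , m) = mirror-Chain c , λ k c' →
  m k (subst₂ (Chain k) (mirror-involutive A) (mirror-involutive B) (mirror-Chain c'))

-- A rotation that ends in `hang A k B` took place in `A`, or made the new root release one adopted
-- root, or took place in `B`. In the last case `k` may grow, but it never falls; this is what makes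
-- the total slack monotone.
Rot-hang⁻¹ : ∀ A k B {T} → k ≤ roots B → Rot T (hang A k B) →
    (Σ Tree λ A' → Rot A' A × (T ≡ hang A' k B))
  ⊎ ((suc k ≤ roots B) × (T ≡ hang A (suc k) B))
  ⊎ (Σ Tree λ B' → Σ ℕ λ k' → Rot B' B × (k ≤ k') × (k' ≤ roots B') × (T ≡ hang A k' B'))
Rot-hang⁻¹ A zero B h rot = inj₂ (inj₁ (s≤s z≤n , refl))
Rot-hang⁻¹ A zero B h (inL r) = inj₁ (_ , r , refl)
Rot-hang⁻¹ A zero B h (inR r) = inj₂ (inj₂ (_ , 0 , r , z≤n , z≤n , refl))
-- Undoing this rotation splits a leftover root of `B` into two leftover roots, hence `suc (suc k)`.
Rot-hang⁻¹ A (suc k) (node B (node C D)) (s≤s h) rot =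
  inj₂ (inj₂ (_ , suc (suc k) , rot , n≤1+n _ , s≤s (s≤s h) , refl))
Rot-hang⁻¹ A (suc k) (node B C) (s≤s h) (inR r) =
  inj₂ (inj₂ (_ , suc k , inR r , ≤-refl , s≤s h , refl))
Rot-hang⁻¹ A (suc k) (node B C) (s≤s h) (inL r) with Rot-hang⁻¹ A k B h r
... | inj₁ (A' , r' , refl) = inj₁ (A' , r' , refl)
... | inj₂ (inj₁ (h' , refl)) = inj₂ (inj₁ (s≤s h' , refl))
... | inj₂ (inj₂ (B' , k' , r' , le , h' , refl)) =
  inj₂ (inj₂ (_ , suc k' , inL r' , s≤s le , s≤s h' , refl))

-- Grafting trees as pairs of trees

slack : ℕ → GTree → ℕ
slack l R = gsize R ∸ (l + labelSum R)

lowerTree upperTree : GTree → Tree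
lowerTree gleaf = leaf
lowerTree (gnode L l R) = hang (lowerTree L) (slack l R) (lowerTree R)
upperTree gleaf = leaf
upperTree (gnode L l R) = node (upperTree L) (upperTree R)

totalSlack : GTree → ℕ
totalSlack gleaf = 0
totalSlack (gnode L l R) = slack l R + (totalSlack L + totalSlack R)

size-upperTree : ∀ G → size (upperTree G) ≡ gsize G
size-upperTree gleaf = refl
size-upperTree (gnode L l R) = cong suc (cong₂ _+_ (size-upperTree L) (size-upperTree R))

size-lowerTree : ∀ G → size (lowerTree G) ≡ gsize G
size-lowerTree gleaf = refl
size-lowerTree (gnode L l R) =
  trans (size-hang (lowerTree L) _ (lowerTree R)) (cong suc (cong₂ _+_ (size-lowerTree L) (size-lowerTree R)))

-- The root count is a hypothesis because `roots-lowerTree` applies this to the right subtree while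
-- it is itself being proved.
slack+label : ∀ G l → roots (lowerTree G) + labelSum G ≡ gsize G → l + labelSum G ≤ gsize G →
  slack l G + l ≡ roots (lowerTree G)
slack+label G l e h = +-cancelʳ-≡ (labelSum G) _ _
  (trans (+-assoc (slack l G) l _) (trans (m∸n+n≡m h) (sym e)))

-- Every node of the lower forest is either a root or adopted by exactly one node, and the labels
-- count adoptions. Hence `slack l R` is the number of roots of `lowerTree R` that are not adopted.
roots-lowerTree : ∀ G → Valid G → roots (lowerTree G) + labelSum G ≡ gsize G
roots-lowerTree gleaf _ = refl
roots-lowerTree (gnode L l R) (vL , vR , h)
  rewrite roots-hang (lowerTree L) (slack l R) (lowerTree R)
            (≤-trans (m≤m+n _ l) (≤-reflexive (slack+label R l (roots-lowerTree R vR) h)))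
  = trans (lem (roots (lowerTree L)) (slack l R) (labelSum L) l (labelSum R))
      (cong suc (cong₂ _+_ (roots-lowerTree L vL) (m∸n+n≡m h)))
  where
  lem : ∀ a s b l c → suc (a + s) + (b + l + c) ≡ suc (a + b + (s + (l + c)))
  lem = solve-∀

slack-label : ∀ G l → Valid G → l + labelSum G ≤ gsize G → slack l G + l ≡ roots (lowerTree G)
slack-label G l v h = slack+label G l (roots-lowerTree G v) h

slack≤roots : ∀ G l → Valid G → l + labelSum G ≤ gsize G → slack l G ≤ roots (lowerTree G)
slack≤roots G l v h = ≤-trans (m≤m+n _ l) (≤-reflexive (slack-label G l v h))

label-of-slack : ∀ G k → Valid G → k ≤ roots (lowerTree G) →
  Σ ℕ λ l → (l + labelSum G ≤ gsize G) × (slack l G ≡ k)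
label-of-slack G k v h = r ∸ k , ≤-trans (+-monoˡ-≤ (labelSum G) (m∸n≤m r k)) (≤-reflexive e)
  , trans (cong (_∸ (r ∸ k + labelSum G)) (sym e))
      (trans (cong (r + labelSum G ∸_) (+-comm (r ∸ k) (labelSum G)))
        (trans (cong (_∸ (labelSum G + (r ∸ k))) (+-comm r (labelSum G)))
          (trans ([m+n]∸[m+o]≡n∸o (labelSum G) r (r ∸ k)) (m∸[m∸n]≡n h))))
  where
  r = roots (lowerTree G)
  e = roots-lowerTree G v

lowerTree-Chain : ∀ G → Valid G → Chain (totalSlack G) (lowerTree G) (upperTree G)
lowerTree-Chain gleaf v = nil
lowerTree-Chain (gnode L l R) (vL , vR , h) =
  hang-Chain (lowerTree L) (slack l R) (lowerTree R) (slack≤roots R l vR h)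
  ++C node-Chain (lowerTree-Chain L vL) (lowerTree-Chain R vR)

graft-≤T : ∀ G → Valid G → lowerTree G ≤T upperTree G
graft-≤T G v = Chain⇒≤T (lowerTree-Chain G v)

-- The upper trees fix the skeleton, and with it the sizes that `hang-injective` needs to locate the
-- new root. The label is then the number of roots minus the slack.
gtree-unique : ∀ G G' → Valid G → Valid G' → lowerTree G ≡ lowerTree G' → upperTree G ≡ upperTree G' → G ≡ G'
gtree-unique gleaf gleaf v v' e e' = refl
gtree-unique gleaf (gnode L l R) v v' e ()
gtree-unique (gnode L l R) gleaf v v' e ()
gtree-unique (gnode L l R) (gnode L' l' R') (vL , vR , h) (vL' , vR' , h') e e'
  with hang-injective (slack l R) (slack l' R') sizes (slack≤roots R l vR h) (slack≤roots R' l' vR' h') e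
  where
  left-part : Tree → Tree
  left-part leaf = leaf
  left-part (node L R) = L
  sizes : size (lowerTree L) ≡ size (lowerTree L')
  sizes = trans (size-lowerTree L) (trans (sym (size-upperTree L))
            (trans (cong (size ∘ left-part) e') (trans (size-upperTree L') (sym (size-lowerTree L')))))
... | eL , es , eR
  with gtree-unique L L' vL vL' eL (cong (λ { leaf → leaf ; (node L R) → L }) e')
     | gtree-unique R R' vR vR' eR (cong (λ { leaf → leaf ; (node L R) → R }) e')
... | refl | refl = cong (λ l → gnode L l R)
  (+-cancelˡ-≡ (slack l R) l l' (trans (slack-label R l vR h)
     (trans (sym (slack-label R l' vR' h')) (cong (_+ l') (sym es)))))

-- Existence of grafting trees, and the distance as total slack

record Graft (T₁ T₂ : Tree) : Set where
  constructor graft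
  field
    tree    : GTree
    valid   : Valid tree
    lower≡  : lowerTree tree ≡ T₁
    upper≡  : upperTree tree ≡ T₂
open Graft

graft-refl : ∀ T → Σ (Graft T T) λ g → totalSlack (tree g) ≡ 0
graft-refl leaf = graft gleaf tt refl refl , refl
graft-refl (node L R) with graft-refl L | graft-refl R
... | graft GL vL refl uL , zL | graft GR vR refl uR , zR with label-of-slack GR 0 vR z≤n
... | l , h , e = graft (gnode GL l GR) (vL , vR , h) (cong (λ k → hang (lowerTree GL) k (lowerTree GR)) e)
                    (cong₂ node uL uR)
                , cong₂ _+_ e (cong₂ _+_ zL zR)

-- Each case of `Rot-hang⁻¹` raises the slack: in the left part by induction, at the node itself by
-- a released root, or in the right part, where `k ≤ k'` keeps the slack of the node from falling.
graft-Rot : ∀ {T} G → Valid G → Rot T (lowerTree G) →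
  Σ (Graft T (upperTree G)) λ g → totalSlack G < totalSlack (tree g)
graft-Rot (gnode L l R) (vL , vR , h) r
  with Rot-hang⁻¹ (lowerTree L) (slack l R) (lowerTree R) (slack≤roots R l vR h) r
... | inj₁ (A , r' , refl) with graft-Rot L vL r'
... | graft G v refl u , lt = graft (gnode G l R) (v , vR , h) refl (cong (λ L → node L (upperTree R)) u)
    , +-monoʳ-< (slack l R) (+-monoˡ-< (totalSlack R) lt)
graft-Rot (gnode L l R) (vL , vR , h) r | inj₂ (inj₁ (h' , refl)) with label-of-slack R (suc (slack l R)) vR h'
... | l' , h'' , e = graft (gnode L l' R) (vL , vR , h'') (cong (λ k → hang (lowerTree L) k (lowerTree R)) e) refl
    , +-monoˡ-< _ (≤-reflexive (sym e))
graft-Rot (gnode L l R) (vL , vR , h) r | inj₂ (inj₂ (B , k , r' , le , h' , refl)) with graft-Rot R vR r'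
... | graft G v refl u , lt with label-of-slack G k v h'
... | l' , h'' , refl = graft (gnode L l' G) (vL , v , h'') refl (cong (node (upperTree L)) u)
    , +-mono-≤-< le (+-monoʳ-< (totalSlack L) lt)

graft-≤T-slack : ∀ {S} G → Valid G → S ≤T lowerTree G →
  Σ (Graft S (upperTree G)) λ g → (totalSlack G ≤ totalSlack (tree g))
    × (S ≢ lowerTree G → totalSlack G < totalSlack (tree g))
graft-≤T-slack G v p = go p refl
  where
  go : ∀ {S T} → S ≤T T → T ≡ lowerTree G → Σ (Graft S (upperTree G)) λ g → (totalSlack G ≤ totalSlack (tree g))
       × (S ≢ T → totalSlack G < totalSlack (tree g))
  go ε refl = graft G v refl refl , ≤-refl , λ n → ⊥-elim (n refl)
  go (r ◅ p) e with go p e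
  ... | graft G' v' refl u , le , _ with graft-Rot G' v' r
  ... | g , lt = subst (λ U → Σ (Graft _ U) λ g → (totalSlack G ≤ totalSlack (tree g)) × (_ → totalSlack G < totalSlack (tree g)))
                   u (g , <⇒≤ (≤-<-trans le lt) , λ _ → ≤-<-trans le lt)

-- Walks down from the grafting tree of the pair `T`, `T`, in which every node adopts all available
-- roots.
grafting : ∀ {S T} → S ≤T T → Graft S T
grafting {S} {T} p with graft-refl T
... | graft G v l u , _ with graft-≤T-slack G v (subst (S ≤T_) (sym l) p)
... | g , _ = subst (Graft S) u g

graft-Chain : ∀ {k S} G → Valid G → Chain k S (lowerTree G) →
  Σ (Graft S (upperTree G)) λ g → k + totalSlack G ≤ totalSlack (tree g)
graft-Chain G v c = go c refl
  where
  go : ∀ {k S T} → Chain k S T → T ≡ lowerTree G →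
       Σ (Graft S (upperTree G)) λ g → k + totalSlack G ≤ totalSlack (tree g)
  go nil refl = graft G v refl refl , ≤-refl
  go (cons (p , n) c) e with go c e
  ... | graft G' v' refl u , le with graft-≤T-slack G' v' p
  ... | g , _ , lt = subst (λ U → Σ (Graft _ U) λ g → suc (_ + totalSlack G) ≤ totalSlack (tree g))
                       u (g , ≤-trans (s≤s le) (lt n))

-- For the bound, a chain of length `k` is walked down from slack 0. The grafting tree reached has
-- slack at least `k`, and it is `G` by uniqueness.
dist-graft : ∀ G → Valid G → IsDist (lowerTree G) (upperTree G) (totalSlack G)
dist-graft G v = lowerTree-Chain G v , bound
  where
  bound : ∀ k → Chain k (lowerTree G) (upperTree G) → k ≤ totalSlack G
  bound k c with graft-refl (upperTree G)
  ... | graft G₀ v₀ l₀ u₀ , z with graft-Chain G₀ v₀ (subst (Chain k (lowerTree G)) (sym l₀) c)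
  ... | graft G' v' l' u' , le with gtree-unique G' G v' v l' (trans u' u₀)
  ... | refl = ≤-trans (m≤m+n k _) le

-- The left branch involution

attach-gleaf : ∀ A → attachLeftmost A gleaf ≡ A
attach-gleaf gleaf = refl
attach-gleaf (gnode A m B) = cong (λ A → gnode A m B) (attach-gleaf A)

attach-assoc : ∀ A B C → attachLeftmost (attachLeftmost A B) C ≡ attachLeftmost A (attachLeftmost B C)
attach-assoc gleaf B C = refl
attach-assoc (gnode A m D) B C = cong (λ A → gnode A m D) (attach-assoc A B C)

-- `LB` reverses the left branch, so it is an antihomomorphism for `attachLeftmost`. The involution
-- law follows by splitting off the root.
LB-attach : ∀ A B → LB (attachLeftmost A B) ≡ attachLeftmost (LB B) (LB A)
LB-attach gleaf B = sym (attach-gleaf (LB B))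
LB-attach (gnode A m D) B =
  trans (cong (λ t → attachLeftmost t (gnode gleaf m (LB D))) (LB-attach A B)) (attach-assoc (LB B) (LB A) _)

LB-involutive : ∀ G → LB (LB G) ≡ G
LB-involutive gleaf = refl
LB-involutive (gnode L l R) =
  trans (LB-attach (LB L) (gnode gleaf l (LB R)))
    (cong₂ (λ L R → gnode L l R) (LB-involutive L) (LB-involutive R))

gsize-attach : ∀ A B → gsize (attachLeftmost A B) ≡ gsize A + gsize B
gsize-attach gleaf B = refl
gsize-attach (gnode A m D) B rewrite gsize-attach A B = lem (gsize A) (gsize B) (gsize D)
  where
  lem : ∀ a b d → suc (a + b + d) ≡ suc (a + d + b)
  lem = solve-∀

labelSum-attach : ∀ A B → labelSum (attachLeftmost A B) ≡ labelSum A + labelSum B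
labelSum-attach gleaf B = refl
labelSum-attach (gnode A m D) B rewrite labelSum-attach A B = lem (labelSum A) (labelSum B) m (labelSum D)
  where
  lem : ∀ a b m d → a + b + m + d ≡ a + m + d + b
  lem = solve-∀

totalSlack-attach : ∀ A B → totalSlack (attachLeftmost A B) ≡ totalSlack A + totalSlack B
totalSlack-attach gleaf B = refl
totalSlack-attach (gnode A m D) B rewrite totalSlack-attach A B =
  lem (slack m D) (totalSlack A) (totalSlack B) (totalSlack D)
  where
  lem : ∀ s a b d → s + (a + b + d) ≡ s + (a + d) + b
  lem = solve-∀

gsize-LB : ∀ G → gsize (LB G) ≡ gsize G
gsize-LB gleaf = refl
gsize-LB (gnode L l R) rewrite gsize-attach (LB L) (gnode gleaf l (LB R)) | gsize-LB L | gsize-LB R = +-suc _ _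

labelSum-LB : ∀ G → labelSum (LB G) ≡ labelSum G
labelSum-LB gleaf = refl
labelSum-LB (gnode L l R) rewrite labelSum-attach (LB L) (gnode gleaf l (LB R)) | labelSum-LB L | labelSum-LB R =
  sym (+-assoc (labelSum L) l (labelSum R))

-- The slack of a node sees its right subtree only through `gsize` and `labelSum`, both invariant
-- under `LB`.
totalSlack-LB : ∀ G → totalSlack (LB G) ≡ totalSlack G
totalSlack-LB gleaf = refl
totalSlack-LB (gnode L l R) rewrite totalSlack-attach (LB L) (gnode gleaf l (LB R))
  | totalSlack-LB L | totalSlack-LB R | gsize-LB R | labelSum-LB R = lem (totalSlack L) (slack l R) (totalSlack R)
  where
  lem : ∀ a s b → a + (s + b) ≡ s + (a + b)
  lem = solve-∀

Valid-attach : ∀ A B → Valid A → Valid B → Valid (attachLeftmost A B)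
Valid-attach gleaf B _ v = v
Valid-attach (gnode A m D) B (vA , vD , h) v = Valid-attach A B vA v , vD , h

Valid-LB : ∀ G → Valid G → Valid (LB G)
Valid-LB gleaf _ = tt
Valid-LB (gnode L l R) (vL , vR , h) = Valid-attach (LB L) _ (Valid-LB L vL)
  (tt , Valid-LB R vR , subst₂ (λ s n → l + s ≤ n) (sym (labelSum-LB R)) (sym (gsize-LB R)) h)

-- Contacts and rises of Dyck paths as lists of numbers

dyck-node-++ : ∀ L R w → dyck (node L R) ++ w ≡ dyck L ++ true ∷ dyck R ++ false ∷ w
dyck-node-++ L R w = trans (++-assoc (dyck L) _ w)
  (cong (λ v → dyck L ++ true ∷ v) (++-assoc (dyck R) _ w))

-- The statistics are computed with an arbitrary suffix `w`, here and below, because the path of a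
-- subtree is always read with the rest of the word behind it.
numUps-dyck-++ : ∀ T w → numUps (dyck T ++ w) ≡ size T + numUps w
numUps-dyck-++ leaf w = refl
numUps-dyck-++ (node L R) w rewrite dyck-node-++ L R w
  | numUps-dyck-++ L (true ∷ dyck R ++ false ∷ w) | numUps-dyck-++ R (false ∷ w) =
  trans (+-suc _ _) (cong suc (sym (+-assoc (size L) (size R) _)))

numUps-dyck : ∀ T → numUps (dyck T) ≡ size T
numUps-dyck T = trans (cong numUps (sym (++-identityʳ (dyck T))))
  (trans (numUps-dyck-++ T []) (+-identityʳ _))

contactsFrom-dyck-++ : ∀ h T w → contactsFrom (suc h) (dyck T ++ w) ≡ contactsFrom (suc h) w
contactsFrom-dyck-++ h leaf w = refl
contactsFrom-dyck-++ h (node L R) w rewrite dyck-node-++ L R w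
  | contactsFrom-dyck-++ h L (true ∷ dyck R ++ false ∷ w) = contactsFrom-dyck-++ (suc h) R (false ∷ w)

contacts-dyck-++ : ∀ T w → contacts (dyck T ++ w) ≡ roots T + contacts w
contacts-dyck-++ leaf w = refl
contacts-dyck-++ (node L R) w rewrite dyck-node-++ L R w
  | contacts-dyck-++ L (true ∷ dyck R ++ false ∷ w) | contactsFrom-dyck-++ 0 R (false ∷ w) = +-suc _ _

contacts-dyck : ∀ T → contacts (dyck T) ≡ roots T
contacts-dyck T = trans (cong contacts (sym (++-identityʳ (dyck T))))
  (trans (contacts-dyck-++ T []) (+-identityʳ _))

takeBal-dyck-++ : ∀ h T w → takeBal h (dyck T ++ w) ≡ dyck T ++ takeBal h w
takeBal-dyck-++ h leaf w = refl
takeBal-dyck-++ h (node L R) w rewrite dyck-node-++ L R w | dyck-node-++ L R (takeBal h w)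
  | takeBal-dyck-++ h L (true ∷ dyck R ++ false ∷ w) | takeBal-dyck-++ (suc h) R (false ∷ w) = refl

contactList : List Bool → List ℕ
contactList [] = []
contactList (true ∷ w) = contacts (takeBal 0 w) ∷ contactList w
contactList (false ∷ w) = contactList w

riseList : List Bool → List ℕ
riseList [] = []
riseList (true ∷ w) = riseList w
riseList (false ∷ w) = rises w ∷ riseList w

applyUpTo-contacts : ∀ m w → m ≤ numUps w →
  applyUpTo (λ i → contacts (takeBal 0 (dropUp i w))) m ≡ take m (contactList w)
applyUpTo-contacts zero w h = refl
applyUpTo-contacts (suc m) (true ∷ w) (s≤s h) = cong (_ ∷_) (applyUpTo-contacts m w h)
applyUpTo-contacts (suc m) (false ∷ w) h = applyUpTo-contacts (suc m) w h

numDowns : List Bool → ℕ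
numDowns [] = 0
numDowns (true ∷ w) = numDowns w
numDowns (false ∷ w) = suc (numDowns w)

applyUpTo-rises : ∀ m w → m ≤ numDowns w →
  applyUpTo (λ i → rises (dropDown i w)) m ≡ take m (riseList w)
applyUpTo-rises zero w h = refl
applyUpTo-rises (suc m) (false ∷ w) (s≤s h) = cong (_ ∷_) (applyUpTo-rises m w h)
applyUpTo-rises (suc m) (true ∷ w) h = applyUpTo-rises (suc m) w h

numDowns-dyck-++ : ∀ T w → numDowns (dyck T ++ w) ≡ size T + numDowns w
numDowns-dyck-++ leaf w = refl
numDowns-dyck-++ (node L R) w rewrite dyck-node-++ L R w
  | numDowns-dyck-++ L (true ∷ dyck R ++ false ∷ w) | numDowns-dyck-++ R (false ∷ w) =
  lem (size L) (size R) (numDowns w)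
  where
  lem : ∀ a b c → a + (b + suc c) ≡ suc (a + b + c)
  lem = solve-∀

numDowns-dyck : ∀ T → numDowns (dyck T) ≡ size T
numDowns-dyck T = trans (cong numDowns (sym (++-identityʳ (dyck T))))
  (trans (numDowns-dyck-++ T []) (+-identityʳ _))

childCounts : Tree → List ℕ
childCounts leaf = []
childCounts (node L R) = childCounts L ++ roots R ∷ childCounts R

contactList-dyck-++ : ∀ T w → contactList (dyck T ++ w) ≡ childCounts T ++ contactList w
contactList-dyck-++ leaf w = refl
contactList-dyck-++ (node L R) w rewrite dyck-node-++ L R w
  | contactList-dyck-++ L (true ∷ dyck R ++ false ∷ w)
  | takeBal-dyck-++ 0 R (false ∷ w)
  | ++-identityʳ (dyck R)
  | contacts-dyck R
  | contactList-dyck-++ R (false ∷ w) = sym (++-assoc (childCounts L) _ _)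

contactList-dyck : ∀ T → contactList (dyck T) ≡ childCounts T
contactList-dyck T = trans (cong contactList (sym (++-identityʳ (dyck T))))
  (trans (contactList-dyck-++ T []) (++-identityʳ _))

incHead : List ℕ → List ℕ
incHead [] = []
incHead (n ∷ ns) = suc n ∷ ns

incHead-++ : ∀ ns m ms → incHead (ns ++ m ∷ ms) ≡ incHead (ns ++ [ m ]) ++ ms
incHead-++ [] m ms = refl
incHead-++ (n ∷ ns) m ms = cong (suc n ∷_) (sym (++-assoc ns [ m ] ms))

-- For a nonempty tree, the indices of the variables in the monomial: the leading statistic, then
-- the local ones up to `n - 1`. The `n`-th local statistic is always 0; it is omitted here, and
-- `++ [ 0 ]` restores it where another node follows.
contactSeq riseSeq : Tree → List ℕ
contactSeq leaf = []
contactSeq (node L R) = incHead (contactSeq L ++ [ 0 ]) ++ contactSeq R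
riseSeq leaf = []
riseSeq (node L R) = riseSeq L ++ incHead (riseSeq R ++ [ 0 ])

contactSeq-spec : ∀ T → roots T ∷ childCounts T ≡ contactSeq T ++ [ 0 ]
contactSeq-spec leaf = refl
contactSeq-spec (node L R) rewrite sym (contactSeq-spec L) = cong (suc (roots L) ∷_)
  (trans (cong (childCounts L ++_) (contactSeq-spec R)) (sym (++-assoc (childCounts L) _ _)))

riseSeq-spec-++ : ∀ T w → rises (dyck T ++ w) ∷ riseList (dyck T ++ w) ≡ riseSeq T ++ (rises w ∷ riseList w)
riseSeq-spec-++ leaf w = refl
riseSeq-spec-++ (node L R) w rewrite dyck-node-++ L R w =
  trans (riseSeq-spec-++ L (true ∷ dyck R ++ false ∷ w))
    (trans (cong (λ s → riseSeq L ++ incHead s) (riseSeq-spec-++ R (false ∷ w)))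
      (trans (cong (riseSeq L ++_) (incHead-++ (riseSeq R) 0 _)) (sym (++-assoc (riseSeq L) _ _))))

riseSeq-spec : ∀ T → rises (dyck T) ∷ riseList (dyck T) ≡ riseSeq T ++ [ 0 ]
riseSeq-spec T = trans (cong (λ w → rises w ∷ riseList w) (sym (++-identityʳ (dyck T)))) (riseSeq-spec-++ T [])

length-incHead : ∀ ns → length (incHead ns) ≡ length ns
length-incHead [] = refl
length-incHead (n ∷ ns) = refl

length-riseSeq : ∀ T → length (riseSeq T) ≡ size T
length-riseSeq leaf = refl
length-riseSeq (node L R) rewrite length-++ (riseSeq L) {incHead (riseSeq R ++ [ 0 ])}
  | length-incHead (riseSeq R ++ [ 0 ]) | length-++ (riseSeq R) {[ 0 ]}
  | length-riseSeq L | length-riseSeq R = trans (cong (size L +_) (+-comm (size R) 1)) (+-suc _ _)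

length-contactSeq : ∀ T → length (contactSeq T) ≡ size T
length-contactSeq leaf = refl
length-contactSeq (node L R) rewrite length-++ (incHead (contactSeq L ++ [ 0 ])) {contactSeq R}
  | length-incHead (contactSeq L ++ [ 0 ]) | length-++ (contactSeq L) {[ 0 ]}
  | length-contactSeq L | length-contactSeq R = cong (_+ size R) (+-comm (size L) 1)

take-length-++ : ∀ {A : Set} (xs ys : List A) → take (length xs) (xs ++ ys) ≡ xs
take-length-++ [] ys = refl
take-length-++ (x ∷ xs) ys = cong (x ∷_) (take-length-++ xs ys)

contactWord riseWord : Tree → List ℕ
contactWord T = roots T ∷ take (size T ∸ 1) (childCounts T)
riseWord T = rises (dyck T) ∷ take (size T ∸ 1) (riseList (dyck T))

-- Stated for nodes because the empty tree differs: its monomial still has the leading factor, so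
-- its word is `[ 0 ]`, while its sequence is empty.
contactWord-node : ∀ L R → contactWord (node L R) ≡ contactSeq (node L R)
contactWord-node L R = trans (cong (take (size T)) (contactSeq-spec T))
  (trans (cong (λ n → take n (contactSeq T ++ [ 0 ])) (sym (length-contactSeq T)))
    (take-length-++ (contactSeq T) [ 0 ]))
  where T = node L R

riseWord-node : ∀ L R → riseWord (node L R) ≡ riseSeq (node L R)
riseWord-node L R = trans (cong (take (size T)) (riseSeq-spec T))
  (trans (cong (λ n → take n (riseSeq T ++ [ 0 ])) (sym (length-riseSeq T)))
    (take-length-++ (riseSeq T) [ 0 ]))
  where T = node L R

module _ (M : CommutativeMonoid 0ℓ 0ℓ) where
  open CommutativeMonoid M using (Carrier; _≈_; _∙_; ∙-cong; ∙-congˡ; assoc; comm)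
    renaming (refl to ≈-refl; sym to ≈-sym; trans to ≈-trans)

  prodM-↭ : (x : ℕ → Carrier) → ∀ {ms ns} → ms ↭ ns → prodM M (map x ms) ≈ prodM M (map x ns)
  prodM-↭ x Perm.refl = ≈-refl
  prodM-↭ x (prep n p) = ∙-congˡ (prodM-↭ x p)
  prodM-↭ x (swap m n p) = ≈-trans (∙-congˡ (∙-congˡ (prodM-↭ x p)))
    (≈-trans (≈-sym (assoc _ _ _)) (≈-trans (∙-cong (comm _ _) ≈-refl) (assoc _ _ _)))
  prodM-↭ x (Perm.trans p q) = ≈-trans (prodM-↭ x p) (prodM-↭ x q)

  map-oneTo : (x : ℕ → Carrier) (f : ℕ → ℕ) → ∀ m → map (λ i → x (f i)) (oneTo m) ≡ map x (applyUpTo (f ∘ suc) m)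
  map-oneTo x f m = trans (map-∘ (oneTo m)) (cong (map x)
    (trans (sym (map-∘ (upTo m))) (map-applyUpTo id (f ∘ suc) m)))

  ContactMon-dyck : (x : ℕ → Carrier) → ∀ T → ContactMon M x (dyck T) ≡ prodM M (map x (contactWord T))
  ContactMon-dyck x T = cong₂ (λ r ns → x r ∙ prodM M ns) (contacts-dyck T)
    (trans (map-oneTo x (λ i → contactsAt i (dyck T)) (numUps (dyck T) ∸ 1)) (cong (map x)
      (trans (applyUpTo-contacts (numUps (dyck T) ∸ 1) (dyck T) (m∸n≤m _ 1))
        (cong₂ (λ n → take (n ∸ 1)) (numUps-dyck T) (contactList-dyck T)))))

  RiseMon-dyck : (x : ℕ → Carrier) → ∀ T → RiseMon M x (dyck T) ≡ prodM M (map x (riseWord T))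
  RiseMon-dyck x T = cong (λ ns → x (rises (dyck T)) ∙ prodM M ns)
    (trans (map-oneTo x (λ i → risesAt i (dyck T)) (numUps (dyck T) ∸ 1)) (cong (map x)
      (trans (applyUpTo-rises (numUps (dyck T) ∸ 1) (dyck T)
                (≤-trans (m∸n≤m _ 1) (≤-reflexive (trans (numUps-dyck T) (sym (numDowns-dyck T))))))
        (cong (λ n → take (n ∸ 1) (riseList (dyck T))) (numUps-dyck T)))))

-- The statistics under LB and mirroring

labels : GTree → List ℕ
labels gleaf = []
labels (gnode L l R) = labels L ++ l ∷ labels R

childCounts-⊕ : ∀ A B → childCounts (A ⊕ B) ≡ childCounts A ++ childCounts B
childCounts-⊕ A leaf = sym (++-identityʳ _)
childCounts-⊕ A (node L R) rewrite childCounts-⊕ A L = ++-assoc (childCounts A) _ _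

-- Hanging gives the new root `l` children and changes no other child count; the part `X` of the
-- split has exactly these `l` roots.
childCounts-hang : ∀ A k B l → k + l ≡ roots B → childCounts (hang A k B) ≡ childCounts A ++ l ∷ childCounts B
childCounts-hang A k B l e with hang-split k B (≤-trans (m≤m+n k l) (≤-reflexive e))
... | X , Y , refl , r , hang≡ rewrite hang≡ A | childCounts-⊕ (node A X) Y | childCounts-⊕ X Y
  | +-cancelʳ-≡ k (roots X) l (trans r (trans (sym e) (+-comm k l))) = ++-assoc (childCounts A) _ _

childCounts-lowerTree : ∀ G → Valid G → childCounts (lowerTree G) ≡ labels G
childCounts-lowerTree gleaf v = refl
childCounts-lowerTree (gnode L l R) (vL , vR , h) =
  trans (childCounts-hang (lowerTree L) (slack l R) (lowerTree R) l (slack-label R l vR h))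
    (cong₂ (λ ms ns → ms ++ l ∷ ns) (childCounts-lowerTree L vL) (childCounts-lowerTree R vR))

labels-attach : ∀ A B → labels (attachLeftmost A B) ↭ labels A ++ labels B
labels-attach gleaf B = ↭-refl
labels-attach (gnode A m D) B =
  ↭-trans (++⁺ʳ (m ∷ labels D) (labels-attach A B))
    (↭-trans (↭-reflexive (++-assoc (labels A) (labels B) _))
      (↭-trans (++⁺ˡ (labels A) (++-comm (labels B) (m ∷ labels D)))
        (↭-reflexive (sym (++-assoc (labels A) (m ∷ labels D) (labels B))))))

labels-LB : ∀ G → labels (LB G) ↭ labels G
labels-LB gleaf = ↭-refl
labels-LB (gnode L l R) = ↭-trans (labels-attach (LB L) (gnode gleaf l (LB R)))
  (++⁺ (labels-LB L) (prep l (labels-LB R)))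

-- The number of roots is the size minus the label sum, and `LB` preserves both.
roots-LB : ∀ G → Valid G → roots (lowerTree (LB G)) ≡ roots (lowerTree G)
roots-LB G v = +-cancelʳ-≡ (labelSum G) _ _
  (trans (cong (roots (lowerTree (LB G)) +_) (sym (labelSum-LB G)))
    (trans (roots-lowerTree (LB G) (Valid-LB G v)) (trans (gsize-LB G) (sym (roots-lowerTree G v)))))

contactSeq-LB : ∀ G → Valid G → contactSeq (lowerTree (LB G)) ↭ contactSeq (lowerTree G)
-- The trailing 0 on either side is moved to the front and cancelled there.
contactSeq-LB G v = drop-∷ (↭-trans (∷↭∷ʳ 0 _) (↭-trans
  (subst₂ _↭_ (contactSeq-spec (lowerTree (LB G))) (contactSeq-spec (lowerTree G))
    (subst₂ (λ m ns → m ∷ ns ↭ roots (lowerTree G) ∷ childCounts (lowerTree G))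
      (sym (roots-LB G v)) (sym (childCounts-lowerTree (LB G) (Valid-LB G v)))
      (prep _ (subst (labels (LB G) ↭_) (sym (childCounts-lowerTree G v)) (labels-LB G)))))
  (↭-sym (∷↭∷ʳ 0 _))))

LBT : Tree → Tree
LBT leaf = leaf
LBT (node L R) = node leaf (LBT R) ⊕ LBT L

upperTree-attach : ∀ A B → upperTree (attachLeftmost A B) ≡ upperTree B ⊕ upperTree A
upperTree-attach gleaf B = refl
upperTree-attach (gnode A m D) B = cong (λ L → node L (upperTree D)) (upperTree-attach A B)

upperTree-LB : ∀ G → upperTree (LB G) ≡ LBT (upperTree G)
upperTree-LB gleaf = refl
upperTree-LB (gnode L l R) = trans (upperTree-attach (LB L) _)
  (cong₂ (λ L R → node leaf R ⊕ L) (upperTree-LB L) (upperTree-LB R))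

contactSeq-mirror-⊕ : ∀ A B → contactSeq (mirror (A ⊕ B)) ≡ contactSeq (mirror B) ++ contactSeq (mirror A)
contactSeq-mirror-⊕ A leaf = refl
contactSeq-mirror-⊕ A (node L R) =
  trans (cong (incHead (contactSeq (mirror R) ++ [ 0 ]) ++_) (contactSeq-mirror-⊕ A L))
    (sym (++-assoc (incHead (contactSeq (mirror R) ++ [ 0 ])) _ _))

-- `riseSeq` lists the nodes of the left branch from the bottom up. Mirroring makes it the right
-- branch, which `contactSeq` lists from the top down; the reversal by `LBT` makes the two orders
-- agree.
riseSeq-LBT : ∀ T → riseSeq T ≡ contactSeq (mirror (LBT T))
riseSeq-LBT leaf = refl
riseSeq-LBT (node L R) = sym (trans (contactSeq-mirror-⊕ (node leaf (LBT R)) (LBT L))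
  (cong₂ (λ ms ns → ms ++ ns) (sym (riseSeq-LBT L))
    (trans (++-identityʳ _) (cong (λ ns → incHead (ns ++ [ 0 ])) (sym (riseSeq-LBT R))))))

contactWord-cong : ∀ {S T} → size S ≡ size T → contactSeq S ↭ contactSeq T → contactWord S ↭ contactWord T
contactWord-cong {leaf} {leaf} s p = ↭-refl
contactWord-cong {node L R} {node L' R'} s p =
  subst₂ _↭_ (sym (contactWord-node L R)) (sym (contactWord-node L' R')) p

riseWord-contactWord : ∀ {S T} → size S ≡ size T → riseSeq S ≡ contactSeq T → riseWord S ≡ contactWord T
riseWord-contactWord {leaf} {leaf} s p = refl
riseWord-contactWord {node L R} {node L' R'} s p =
  trans (riseWord-node L R) (trans p (sym (contactWord-node L' R')))

module _ (G G' : GTree) (v' : Valid G') (e : lowerTree G' ≡ mirror (upperTree (LB G))) where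

  -- Before the last `LB` the words agree letter by letter. The last `LB` keeps the head, which
  -- gives the equality of rises and contacts, and permutes the rest.
  riseWord-upperTree : riseWord (upperTree G) ≡ contactWord (lowerTree G')
  riseWord-upperTree = riseWord-contactWord
    (trans (size-upperTree G) (trans (sym (gsize-LB G)) (trans (sym (size-upperTree (LB G)))
      (trans (sym (size-mirror (upperTree (LB G)))) (cong size (sym e))))))
    (trans (riseSeq-LBT (upperTree G)) (cong contactSeq (trans (cong mirror (sym (upperTree-LB G))) (sym e))))

  rises≡contacts : rises (dyck (upperTree G)) ≡ contacts (dyck (lowerTree (LB G')))
  rises≡contacts = trans (∷-injectiveˡ riseWord-upperTree)
    (trans (sym (roots-LB G' v')) (sym (contacts-dyck (lowerTree (LB G')))))

  RiseMon≈ContactMon : (M : CommutativeMonoid 0ℓ 0ℓ) (x : ℕ → CommutativeMonoid.Carrier M) →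
    CommutativeMonoid._≈_ M (RiseMon M x (dyck (upperTree G))) (ContactMon M x (dyck (lowerTree (LB G'))))
  RiseMon≈ContactMon M x = subst₂ (CommutativeMonoid._≈_ M)
    (sym (trans (RiseMon-dyck M x (upperTree G)) (cong (λ ns → prodM M (map x ns)) riseWord-upperTree)))
    (sym (ContactMon-dyck M x (lowerTree (LB G'))))
    (prodM-↭ M x (↭-sym (contactWord-cong
      (trans (size-lowerTree (LB G')) (trans (gsize-LB G') (sym (size-lowerTree G')))) (contactSeq-LB G' v'))))

-- Subtree membership

InR-bounds : ∀ {T a b} → InR T a b → (1 ≤ a) × (a < b) × (b ≤ size T)
InR-bounds (here h h') = s≤s z≤n , h , h'
InR-bounds (left {L} {R} p) with InR-bounds p
... | x , y , z = x , y , ≤-trans z (≤-trans (m≤m+n _ (size R)) (n≤1+n _))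
InR-bounds (right {L} {R} p) with InR-bounds p
... | x , y , z = s≤s z≤n , +-monoʳ-< (suc (size L)) y , +-monoʳ-≤ (suc (size L)) z

InR-< : ∀ {T a b} → InR T a b → a < b
InR-< p = proj₁ (proj₂ (InR-bounds p))

InR-size : ∀ {T a b} → InR T a b → b ≤ size T
InR-size p = proj₂ (proj₂ (InR-bounds p))

-- The constructors have sums as indices; these variants accept an index up to a proved equation.
hereR : ∀ {L R x y} → x ≡ suc (size L) → x < y → y ≤ suc (size L) + size R → InR (node L R) x y
hereR refl = here

rightR : ∀ {L R x y a b} → x ≡ suc (size L) + a → y ≡ suc (size L) + b → InR R a b → InR (node L R) x y
rightR refl refl = right

hereL : ∀ {L R a x} → x ≡ suc (size L) → 1 ≤ a → a ≤ size L → InL (node L R) a x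
hereL refl = here

rightL : ∀ {L R x y a b} → x ≡ suc (size L) + a → y ≡ suc (size L) + b → InL R a b → InL (node L R) x y
rightL refl refl = right

InR-left⁻¹ : ∀ {L R a b} → InR (node L R) a b → a ≤ size L → InR L a b
InR-left⁻¹ (here _ _) h = ⊥-elim (1+n≰n h)
InR-left⁻¹ (left p) h = p
InR-left⁻¹ {L} (right p) h = ⊥-elim (m+n≮m (size L) _ h)

InR-right⁻¹ : ∀ {L R x y a b} → InR (node L R) x y → x ≡ suc (size L) + a → y ≡ suc (size L) + b → 1 ≤ a → InR R a b
InR-right⁻¹ {L} {a = suc a} (here _ _) e e' h = ⊥-elim (m+1+n≢m (size L) (suc-injective (sym e)))
InR-right⁻¹ {L} (left p) refl e' h =
  ⊥-elim (m+n≮m (size L) _ (≤-trans (<⇒≤ (InR-< p)) (InR-size p)))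
InR-right⁻¹ {L} (right p) e e' h
  with +-cancelˡ-≡ (suc (size L)) _ _ e | +-cancelˡ-≡ (suc (size L)) _ _ e'
... | refl | refl = p

InR-trans : ∀ {T a b c} → InR T a b → InR T b c → InR T a c
InR-trans (here h h') q = here (<-trans h (InR-< q)) (InR-size q)
InR-trans (left p) q = left (InR-trans p (InR-left⁻¹ q (InR-size p)))
InR-trans {node L R} {c = c} (right {b = b} p) q
  with m≤n⇒∃[o]m+o≡n (≤-trans (m≤m+n (suc (size L)) b) (<⇒≤ (InR-< q)))
... | o , refl = right (InR-trans p (InR-right⁻¹ q refl refl (≤-trans (proj₁ (InR-bounds p)) (<⇒≤ (InR-< p)))))

InR-convex : ∀ {T a b c} → InR T a c → a < b → b ≤ c → InR T a b
InR-convex (here h h') l m = here l (≤-trans m h')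
InR-convex (left p) l m = left (InR-convex p l m)
InR-convex {node L R} (right {a = a} p) l m with m≤n⇒∃[o]m+o≡n (≤-trans (m≤m+n (suc (size L)) a) (<⇒≤ l))
... | o , refl = right (InR-convex p (+-cancelˡ-< (suc (size L)) _ _ l) (+-cancelˡ-≤ (suc (size L)) _ _ m))

-- A right rotation only enlarges right subtrees: the lower of the two rotated nodes gains the other
-- one together with `C`.
InR-Rot : ∀ {S T a b} → Rot S T → InR S a b → InR T a b
InR-Rot {b = b} (rot {A} {B} {C}) (here h h')
  with m≤n⇒∃[o]m+o≡n (≤-trans (≤-trans (m≤m+n (suc (size A)) (size B)) (n≤1+n _)) (<⇒≤ h))
... | o , refl = rightR (sym (+-suc (suc (size A)) (size B))) refl
  (here (+-cancelˡ-< (suc (size A)) _ _ (subst (_< suc (size A) + o) (sym (+-suc (suc (size A)) (size B))) h))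
        (+-cancelˡ-≤ (suc (size A)) _ _ (subst (suc (size A) + o ≤_) (lem (size A) (size B) (size C)) h')))
  where
  lem : ∀ a b c → suc (suc (a + b)) + c ≡ suc a + (suc b + c)
  lem = solve-∀
InR-Rot (rot {A} {B} {C}) (left (here h h')) =
  here h (≤-trans h' (+-monoʳ-≤ (suc (size A)) (≤-trans (m≤m+n _ (size C)) (n≤1+n _))))
InR-Rot rot (left (left p)) = left p
InR-Rot rot (left (right p)) = right (left p)
InR-Rot (rot {A} {B} {C}) (right p) = rightR (lem (size A) (size B) _) (lem (size A) (size B) _) (right p)
  where
  lem : ∀ a b x → suc (suc (a + b)) + x ≡ suc a + (suc b + x)
  lem = solve-∀
InR-Rot (inL {L} {L'} r) (here h h') =
  hereR (cong suc (size-Rot r)) h (subst (λ n → _ ≤ suc n + _) (size-Rot r) h')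
InR-Rot (inL r) (left p) = left (InR-Rot r p)
InR-Rot (inL r) (right p) = rightR (cong (λ n → suc n + _) (size-Rot r)) (cong (λ n → suc n + _) (size-Rot r)) p
InR-Rot (inR {L} r) (here h h') = here h (subst (λ n → _ ≤ suc (size L) + n) (size-Rot r) h')
InR-Rot (inR r) (left p) = left p
InR-Rot (inR r) (right p) = right (InR-Rot r p)

InR-≤T : ∀ {S T a b} → S ≤T T → InR S a b → InR T a b
InR-≤T ε p = p
InR-≤T (r ◅ s) p = InR-≤T s (InR-Rot r p)

InL-bounds : ∀ {T a b} → InL T a b → (1 ≤ a) × (a < b) × (b ≤ size T)
InL-bounds (here {L} {R} h h') = h , s≤s h' , s≤s (m≤m+n (size L) (size R))
InL-bounds (left {L} {R} p) with InL-bounds p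
... | x , y , z = x , y , ≤-trans z (≤-trans (m≤m+n _ (size R)) (n≤1+n _))
InL-bounds (right {L} {R} p) with InL-bounds p
... | x , y , z = s≤s z≤n , +-monoʳ-< (suc (size L)) y , +-monoʳ-≤ (suc (size L)) z

InL-< : ∀ {T a b} → InL T a b → a < b
InL-< p = proj₁ (proj₂ (InL-bounds p))

InL-size : ∀ {T a b} → InL T a b → b ≤ size T
InL-size p = proj₂ (proj₂ (InL-bounds p))

InL-InR-disjoint : ∀ {T a b} → InL T a b → ¬ InR T a b
InL-InR-disjoint (here h h') q = 1+n≰n (InR-size (InR-left⁻¹ q h'))
InL-InR-disjoint (left p) q =
  InL-InR-disjoint p (InR-left⁻¹ q (≤-trans (<⇒≤ (InL-< p)) (InL-size p)))
InL-InR-disjoint (right p) q = InL-InR-disjoint p (InR-right⁻¹ q refl refl (proj₁ (InL-bounds p)))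

-- Reversal of the in-order labels

-- Opposite labels are related by `a + a' ≡ suc n`, which is symmetric and open to cancellation,
-- unlike truncated subtraction.
opposite : ∀ {n a} → a ≤ n → Σ ℕ λ a' → a + a' ≡ suc n
opposite {n} {a} h = suc n ∸ a , m+[n∸m]≡n (≤-trans h (n≤1+n n))

mirror-here : ∀ l r {a'} → suc l + a' ≡ suc (suc (l + r)) → a' ≡ suc r
mirror-here l r e = +-cancelˡ-≡ l _ _ (suc-injective (trans e (cong suc (sym (+-suc l r)))))

mirror-left : ∀ l r {a a'} → a ≤ l → a + a' ≡ suc (suc (l + r)) → Σ ℕ λ a'' → (a' ≡ suc r + a'') × (a + a'' ≡ suc l)
mirror-left l r {a} {a'} h e with opposite h
... | a'' , e' = a'' , +-cancelˡ-≡ a _ _ (trans e (trans (cong (λ m → suc (m + r)) (sym e')) (lem a a'' r))) , e'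
  where
  lem : ∀ a b r → suc (a + b + r) ≡ a + (suc r + b)
  lem = solve-∀

mirror-right : ∀ l r {a a'} → suc l + a + a' ≡ suc (suc (l + r)) → a + a' ≡ suc r
mirror-right l r {a} {a'} e = mirror-here l r (trans (sym (+-assoc (suc l) a a')) e)

mirror-far : ∀ l r {b b'} → suc l < b → b ≤ suc l + r → b + b' ≡ suc (suc (l + r)) → (1 ≤ b') × (b' ≤ r)
mirror-far l r {b} {b'} h h' e =
    +-cancelˡ-≤ b _ _ (≤-trans (≤-reflexive (+-comm b 1)) (≤-trans (s≤s h') (≤-reflexive (sym e))))
  , +-cancelˡ-≤ (suc (suc l)) _ _ (≤-trans (+-monoˡ-≤ b' h) (≤-reflexive e))

mirror-near : ∀ l r {b b'} → 1 ≤ b → b ≤ l → b + b' ≡ suc (suc (l + r)) → (suc r < b') × (b' ≤ suc r + l)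
mirror-near l r {b} {b'} h h' e =
    +-cancelˡ-≤ l _ _ (≤-trans (≤-reflexive (lem l r)) (≤-trans (≤-reflexive (sym e)) (+-monoˡ-≤ b' h')))
  , ≤-pred (≤-trans (+-monoˡ-≤ b' h) (≤-reflexive (trans e (cong (λ m → suc (suc m)) (+-comm l r)))))
  where
  lem : ∀ l r → l + suc (suc r) ≡ suc (suc (l + r))
  lem = solve-∀

InR-mirror : ∀ T {a b a' b'} → InR T a b → a + a' ≡ suc (size T) → b + b' ≡ suc (size T) → InL (mirror T) b' a'
InR-mirror (node L R) (here h h') e e' with mirror-here (size L) (size R) e | mirror-far (size L) (size R) h h' e'
... | refl | p , q = hereL (cong suc (sym (size-mirror R))) p (subst (_ ≤_) (sym (size-mirror R)) q)
InR-mirror (node L R) (left p) e e' with InR-bounds p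
... | _ , h , h' with mirror-left (size L) (size R) (≤-trans (<⇒≤ h) h') e | mirror-left (size L) (size R) h' e'
... | a'' , refl , f | b'' , refl , f' = rightL (cong (λ m → suc m + b'') (sym (size-mirror R)))
                                             (cong (λ m → suc m + a'') (sym (size-mirror R))) (InR-mirror L p f f')
InR-mirror (node L R) (right p) e e' =
  left (InR-mirror R p (mirror-right (size L) (size R) e) (mirror-right (size L) (size R) e'))

InL-mirror : ∀ T {a b a' b'} → InL T a b → a + a' ≡ suc (size T) → b + b' ≡ suc (size T) → InR (mirror T) b' a'
InL-mirror (node L R) (here h h') e e' with mirror-here (size L) (size R) e' | mirror-near (size L) (size R) h h' e
... | refl | p , q = hereR (cong suc (sym (size-mirror R))) p
  (subst₂ (λ m n → _ ≤ suc m + n) (sym (size-mirror R)) (sym (size-mirror L)) q)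
InL-mirror (node L R) (left p) e e' with InL-bounds p
... | _ , h , h' with mirror-left (size L) (size R) (≤-trans (<⇒≤ h) h') e | mirror-left (size L) (size R) h' e'
... | a'' , refl , f | b'' , refl , f' = rightR (cong (λ m → suc m + b'') (sym (size-mirror R)))
                                             (cong (λ m → suc m + a'') (sym (size-mirror R))) (InL-mirror L p f f')
InL-mirror (node L R) (right p) e e' =
  left (InL-mirror R p (mirror-right (size L) (size R) e) (mirror-right (size L) (size R) e'))

InL⇒InR-mirror : ∀ {T a b} → InL T a b → Σ ℕ λ a' → Σ ℕ λ b' →
  (a + a' ≡ suc (size T)) × (b + b' ≡ suc (size T)) × InR (mirror T) b' a'
InL⇒InR-mirror {T} p with InL-bounds p
... | _ , h , h' with opposite (≤-trans (<⇒≤ h) h') | opposite h'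
... | a' , e | b' , e' = a' , b' , e , e' , InL-mirror T p e e'

InR-mirror⁻¹ : ∀ T {a b a' b'} → InR (mirror T) b' a' → a + a' ≡ suc (size T) → b + b' ≡ suc (size T) → InL T a b
InR-mirror⁻¹ T {a} {b} {a'} {b'} p e e' = subst (λ T → InL T a b) (mirror-involutive T)
  (InR-mirror (mirror T) p (trans (+-comm b' b) (trans e' (cong suc (sym (size-mirror T)))))
                           (trans (+-comm a' a) (trans e (cong suc (sym (size-mirror T))))))

opposite-< : ∀ {n a b a' b'} → a + a' ≡ n → b + b' ≡ n → a < b → b' < a'
opposite-< {a = a} {b} {a'} {b'} e e' h = +-cancelˡ-≤ a _ _
  (≤-trans (≤-reflexive (+-suc a b')) (≤-trans (+-monoˡ-≤ b' h) (≤-reflexive (trans e' (sym e)))))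

opposite-≤ : ∀ {n a b a' b'} → a + a' ≡ n → b + b' ≡ n → a ≤ b → b' ≤ a'
opposite-≤ {a = a} {b} {a'} {b'} e e' h = +-cancelˡ-≤ a _ _
  (≤-trans (+-monoˡ-≤ b' h) (≤-reflexive (trans e' (sym e))))

InL-trans : ∀ {T a b c} → InL T a b → InL T b c → InL T a c
InL-trans {T} {b = b} p q with InL⇒InR-mirror p | InL⇒InR-mirror q
... | a' , b' , ea , eb , p' | b'' , c' , eb' , ec , q' with +-cancelˡ-≡ b b' b'' (trans eb (sym eb'))
... | refl = InR-mirror⁻¹ T (InR-trans q' p') ea ec

InL-convex : ∀ {T a b c} → InL T a c → a ≤ b → b < c → InL T b c
InL-convex {T} p h h' with InL⇒InR-mirror p | opposite (≤-trans (<⇒≤ h') (InL-size p))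
... | a' , c' , ea , ec , p' | b' , eb =
  InR-mirror⁻¹ T (InR-convex p' (opposite-< eb ec h') (opposite-≤ ea eb h)) eb ec

-- If the left subtrees differed in size, the root of the tree with the smaller one would have the
-- root label of the other tree in its right subtree. In that other tree this label lies in no right
-- subtree.
InR-determines : ∀ S T → size S ≡ size T → (∀ {a b} → InR S a b → InR T a b) → (∀ {a b} → InR T a b → InR S a b) → S ≡ T
InR-determines leaf leaf s f g = refl
InR-determines leaf (node _ _) () f g
InR-determines (node _ _) leaf () f g
InR-determines (node L R) (node L' R') s f g with <-cmp (size L) (size L')
... | tri< lt _ _ = ⊥-elim (1+n≰n (proj₂ (proj₂ (InR-bounds (InR-left⁻¹ (f (here (s≤s lt)
    (subst (suc (size L') ≤_) (sym s) (s≤s (m≤m+n _ _))))) lt)))))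
... | tri> _ _ gt = ⊥-elim (1+n≰n (proj₂ (proj₂ (InR-bounds (InR-left⁻¹ (g (here (s≤s gt)
    (subst (suc (size L) ≤_) s (s≤s (m≤m+n _ _))))) gt)))))
... | tri≈ _ e _ = cong₂ node
  (InR-determines L L' e (λ p → InR-left⁻¹ (f (left p)) (subst (_ ≤_) e (a≤ p)))
                         (λ p → InR-left⁻¹ (g (left p)) (subst (_ ≤_) (sym e) (a≤ p))))
  (InR-determines R R' (+-cancelˡ-≡ (size L) _ _ (trans (suc-injective s) (cong (_+ size R') (sym e))))
    (λ p → InR-right⁻¹ (f (right p)) (cong (λ m → suc m + _) e) (cong (λ m → suc m + _) e) (proj₁ (InR-bounds p)))
    (λ p → InR-right⁻¹ (g (right p)) (cong (λ m → suc m + _) (sym e)) (cong (λ m → suc m + _) (sym e)) (proj₁ (InR-bounds p))))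
  where
  a≤ : ∀ {T a b} → InR T a b → a ≤ size T
  a≤ p = ≤-trans (<⇒≤ (InR-< p)) (InR-size p)

InR-mirror-⊆ : ∀ S T → size S ≡ size T → (∀ {a b} → InL S a b → InL T a b) →
  ∀ {a b} → InR (mirror S) a b → InR (mirror T) a b
InR-mirror-⊆ S T s f {a} {b} p with InR-bounds p
... | _ , h , h' with opposite (subst (a ≤_) (size-mirror S) (≤-trans (<⇒≤ h) h')) | opposite (subst (b ≤_) (size-mirror S) h')
... | a' , e | b' , e' = InL-mirror T (f (InR-mirror⁻¹ S p (trans (+-comm b' b) e') (trans (+-comm a' a) e)))
                           (trans (+-comm b' b) (trans e' (cong suc s))) (trans (+-comm a' a) (trans e (cong suc s)))

InL-determines : ∀ S T → size S ≡ size T → (∀ {a b} → InL S a b → InL T a b) → (∀ {a b} → InL T a b → InL S a b) → S ≡ T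
InL-determines S T s f g = mirror-injective (InR-determines (mirror S) (mirror T)
  (trans (size-mirror S) (trans s (sym (size-mirror T)))) (InR-mirror-⊆ S T s f) (InR-mirror-⊆ T S (sym s) g))

InR-⊕ˡ : ∀ {A a b} B → InR A a b → InR (A ⊕ B) a b
InR-⊕ˡ leaf p = p
InR-⊕ˡ (node L R) p = left (InR-⊕ˡ L p)

InR-⊕ʳ : ∀ {a b} A B → InR B a b → InR (A ⊕ B) (size A + a) (size A + b)
InR-⊕ʳ {b = b} A (node L R) (here h h') = hereR
  (trans (+-suc _ _) (cong suc (sym (size-⊕ A L))))
  (+-monoʳ-< (size A) h)
  (≤-trans (+-monoʳ-≤ (size A) h') (≤-reflexive
    (trans (lem (size A) (size L) (size R)) (cong (λ m → suc m + size R) (sym (size-⊕ A L))))))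
  where
  lem : ∀ a l r → a + (suc l + r) ≡ suc (a + l) + r
  lem = solve-∀
InR-⊕ʳ A (node L R) (left p) = left (InR-⊕ʳ A L p)
InR-⊕ʳ A (node L R) (right p) = rightR (shift _) (shift _) p
  where
  lem : ∀ a l r → a + (suc l + r) ≡ suc (a + l) + r
  lem = solve-∀
  shift : ∀ x → size A + (suc (size L) + x) ≡ suc (size (A ⊕ L)) + x
  shift x = trans (lem (size A) (size L) x) (cong (λ m → suc m + x) (sym (size-⊕ A L)))

InR-⊕⁻¹ : ∀ A B {a b} → InR (A ⊕ B) a b →
  InR A a b ⊎ (Σ ℕ λ a' → Σ ℕ λ b' → (a ≡ size A + a') × (b ≡ size A + b') × InR B a' b')
InR-⊕⁻¹ A leaf p = inj₁ p
InR-⊕⁻¹ A (node L R) (here h h') rewrite size-⊕ A L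
  with m≤n⇒∃[o]m+o≡n (≤-trans (≤-trans (m≤m+n (size A) (size L)) (n≤1+n _)) (<⇒≤ h))
... | o , refl = inj₂ (suc (size L) , o , sym (+-suc _ _) , refl
  , here (+-cancelˡ-< (size A) _ _ (subst (_< size A + o) (sym (+-suc _ _)) h))
         (+-cancelˡ-≤ (size A) _ _ (subst (size A + o ≤_) (lem (size A) (size L) (size R)) h')))
  where
  lem : ∀ a l r → suc (a + l) + r ≡ a + (suc l + r)
  lem = solve-∀
InR-⊕⁻¹ A (node L R) (left p) with InR-⊕⁻¹ A L p
... | inj₁ q = inj₁ q
... | inj₂ (a' , b' , e , e' , q) = inj₂ (a' , b' , e , e' , left q)
InR-⊕⁻¹ A (node L R) (right {a = a} {b = b} p) rewrite size-⊕ A L =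
  inj₂ (_ , _ , lem (size A) (size L) a , lem (size A) (size L) b , right p)
  where
  lem : ∀ a l r → suc (a + l) + r ≡ a + (suc l + r)
  lem = solve-∀

-- Interval-posets

iposT : Tree → Tree → IPos
iposT T₁ T₂ = record
  { sz  = size T₁
  ; rel = λ a b → (1 ≤ a × a ≤ size T₁ × a ≡ b) ⊎ InL T₂ a b ⊎ InR T₁ b a }

pattern eqv h h' = inj₁ (h , h' , refl)
pattern inc p = inj₂ (inj₁ p)
pattern dec p = inj₂ (inj₂ p)

≋-sym : ∀ {P Q} → P ≋ Q → Q ≋ P
≋-sym (s , f) = sym s , λ i j → proj₂ (f i j) , proj₁ (f i j)

≋-trans : ∀ {P Q R} → P ≋ Q → Q ≋ R → P ≋ R
≋-trans (s , f) (t , g) = trans s t , λ i j →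
  (λ p → proj₁ (g i j) (proj₁ (f i j) p)) , (λ r → proj₂ (f i j) (proj₂ (g i j) r))

compl-cong : ∀ {P Q} → P ≋ Q → compl P ≋ compl Q
compl-cong {record { sz = n }} {record { sz = .n }} (refl , f) = refl , λ i j → f (suc n ∸ i) (suc n ∸ j)

rel-bounds : ∀ {T₁ T₂ a b} → size T₁ ≡ size T₂ → rel (iposT T₁ T₂) a b →
  (1 ≤ a × a ≤ size T₁) × (1 ≤ b × b ≤ size T₁)
rel-bounds s (eqv h h') = (h , h') , (h , h')
rel-bounds {b = b} s (inc p) with InL-bounds p
... | h , l , h' rewrite s = (h , ≤-trans (<⇒≤ l) h') , (≤-trans h (<⇒≤ l) , h')
rel-bounds s (dec p) with InR-bounds p
... | h , l , h' = (≤-trans h (<⇒≤ l) , h') , (h , ≤-trans (<⇒≤ l) h')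

iposT-injective : ∀ {S₁ S₂ T₁ T₂} → size S₁ ≡ size S₂ → size T₁ ≡ size T₂ →
  iposT S₁ S₂ ≋ iposT T₁ T₂ → (S₁ ≡ T₁) × (S₂ ≡ T₂)
iposT-injective {S₁} {S₂} {T₁} {T₂} s t e@(n , _) =
    InR-determines S₁ T₁ n (λ p → InR-⊆ e p) (λ p → InR-⊆ (≋-sym e) p)
  , InL-determines S₂ T₂ (trans (sym s) (trans n t)) (λ p → InL-⊆ e p) (λ p → InL-⊆ (≋-sym e) p)
  where
  InR-⊆ : ∀ {S₁ S₂ T₁ T₂ a b} → iposT S₁ S₂ ≋ iposT T₁ T₂ → InR S₁ a b → InR T₁ a b
  InR-⊆ (_ , f) p with proj₁ (f _ _) (dec p)
  ... | eqv _ _ = ⊥-elim (<-irrefl refl (InR-< p))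
  ... | inc q = ⊥-elim (<-asym (InR-< p) (InL-< q))
  ... | dec q = q
  InL-⊆ : ∀ {S₁ S₂ T₁ T₂ a b} → iposT S₁ S₂ ≋ iposT T₁ T₂ → InL S₂ a b → InL T₂ a b
  InL-⊆ (_ , f) p with proj₁ (f _ _) (inc p)
  ... | eqv _ _ = ⊥-elim (<-irrefl refl (InL-< p))
  ... | inc q = q
  ... | dec q = ⊥-elim (<-asym (InL-< p) (InR-< q))

-- Mixed compositions use convexity of subtrees. If the result pointed the wrong way, one label
-- would lie in a left and in a right subtree of the same node of `T₂`; `InR-≤T` carries the
-- decreasing relation there.
iposT-trans : ∀ {T₁ T₂ a b c} → T₁ ≤T T₂ → rel (iposT T₁ T₂) a b → rel (iposT T₁ T₂) b c → rel (iposT T₁ T₂) a c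
iposT-trans le (eqv _ _) q = q
iposT-trans le p (eqv _ _) = p
iposT-trans le (inc p) (inc q) = inc (InL-trans p q)
iposT-trans le (dec p) (dec q) = dec (InR-trans q p)
iposT-trans {a = a} {c = c} le (inc p) (dec q) with <-cmp a c
... | tri< lt _ _ =
  ⊥-elim (InL-InR-disjoint (InL-convex p (<⇒≤ lt) (InR-< q)) (InR-≤T le q))
... | tri≈ _ refl _ with InL-bounds p | InR-bounds q
...   | h , l , _ | _ , _ , h' = eqv h (≤-trans (<⇒≤ l) h')
iposT-trans le (inc p) (dec q) | tri> _ _ gt = dec (InR-convex q gt (<⇒≤ (InL-< p)))
iposT-trans {a = a} {c = c} le (dec p) (inc q) with <-cmp a c
... | tri< lt _ _ = inc (InL-convex q (<⇒≤ (InR-< p)) lt)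
... | tri≈ _ refl _ with InR-bounds p
...   | h , l , h' = eqv (≤-trans h (<⇒≤ l)) h'
iposT-trans le (dec p) (inc q) | tri> _ _ gt =
  ⊥-elim (InL-InR-disjoint q (InR-≤T le (InR-convex p (InL-< q) (<⇒≤ gt))))

-- Relations hold only between positive labels, so wherever the complement has a relation its
-- subtraction was not truncated.
1≤m∸n⇒n+[m∸n]≡m : ∀ m n → 1 ≤ m ∸ n → n + (m ∸ n) ≡ m
1≤m∸n⇒n+[m∸n]≡m m zero h = refl
1≤m∸n⇒n+[m∸n]≡m (suc m) (suc n) h = cong suc (1≤m∸n⇒n+[m∸n]≡m m n h)

compl-iposT : ∀ {T₁ T₂} → size T₁ ≡ size T₂ → compl (iposT T₁ T₂) ≋ iposT (mirror T₂) (mirror T₁)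
compl-iposT {T₁} {T₂} s = trans s (sym (size-mirror T₂)) , λ i j → to i j , from i j
  where
  n = size T₁
  s' : size (mirror T₂) ≡ n
  s' = trans (size-mirror T₂) (sym s)
  to : ∀ i j → rel (compl (iposT T₁ T₂)) i j → rel (iposT (mirror T₂) (mirror T₁)) i j
  to i j r with rel-bounds s r
  ... | (h₁ , h₂) , (h₃ , h₄) with 1≤m∸n⇒n+[m∸n]≡m (suc n) i h₁ | 1≤m∸n⇒n+[m∸n]≡m (suc n) j h₃
  to i j (inj₁ (_ , _ , e)) | (h₁ , h₂) , (h₃ , h₄) | ei | ej
    with +-cancelʳ-≡ (suc n ∸ i) i j (trans ei (sym (trans (cong (j +_) e) ej)))
  ... | refl = eqv (+-cancelʳ-≤ (suc n ∸ i) 1 i (≤-trans (s≤s h₂) (≤-reflexive (sym ei))))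
                   (subst (i ≤_) (sym s') (≤-pred (≤-trans (≤-reflexive (+-comm 1 i))
                      (≤-trans (+-monoʳ-≤ i h₁) (≤-reflexive ei)))))
  to i j (inc p) | _ | ei | ej = dec (InL-mirror T₂ p (trans (+-comm (suc n ∸ i) i) (trans ei (cong suc s)))
                                                     (trans (+-comm (suc n ∸ j) j) (trans ej (cong suc s))))
  to i j (dec p) | _ | ei | ej = inc (InR-mirror T₁ p (trans (+-comm (suc n ∸ j) j) ej) (trans (+-comm (suc n ∸ i) i) ei))
  from : ∀ i j → rel (iposT (mirror T₂) (mirror T₁)) i j → rel (compl (iposT T₁ T₂)) i j
  from i j r with rel-bounds (trans s' (sym (size-mirror T₁))) r
  ... | (h₁ , h₂) , (h₃ , h₄) with m+[n∸m]≡n (≤-trans (subst (i ≤_) s' h₂) (n≤1+n n)) | m+[n∸m]≡n (≤-trans (subst (j ≤_) s' h₄) (n≤1+n n))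
  from i j (eqv _ _) | (h₁ , h₂) , _ | ei | ej =
    inj₁ (+-cancelˡ-≤ i _ _ (≤-trans (≤-reflexive (+-comm i 1)) (≤-trans (s≤s (subst (i ≤_) s' h₂)) (≤-reflexive (sym ei))))
        , ≤-pred (≤-trans (+-monoˡ-≤ (suc n ∸ i) h₁) (≤-reflexive ei)) , refl)
  from i j (inc p) | _ | ei | ej =
    dec (subst (λ T → InR T (suc n ∸ j) (suc n ∸ i)) (mirror-involutive T₁)
      (InL-mirror (mirror T₁) p (trans ei (cong suc (sym (size-mirror T₁)))) (trans ej (cong suc (sym (size-mirror T₁))))))
  from i j (dec p) | _ | ei | ej =
    inc (subst (λ T → InL T (suc n ∸ i) (suc n ∸ j)) (mirror-involutive T₂)
      (InR-mirror (mirror T₂) p (trans ej (cong suc (sym s'))) (trans ei (cong suc (sym s')))))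

-- Counting decreasing roots

count-map : ∀ {P Q : ℕ → Set} {n k} → (∀ {y} → 1 ≤ y → y ≤ n → (P y → Q y) × (Q y → P y)) →
  CountUpTo P n k → CountUpTo Q n k
count-map f c0 = c0
count-map f (cyes p c) = cyes (proj₁ (f (s≤s z≤n) ≤-refl) p) (count-map (λ h h' → f h (m≤n⇒m≤1+n h')) c)
count-map f (cno p c) = cno (p ∘ proj₂ (f (s≤s z≤n) ≤-refl)) (count-map (λ h h' → f h (m≤n⇒m≤1+n h')) c)

count-unique : ∀ {P : ℕ → Set} {n k k'} → CountUpTo P n k → CountUpTo P n k' → k ≡ k'
count-unique c0 c0 = refl
count-unique (cyes p c) (cyes p' c') = cong suc (count-unique c c')
count-unique (cyes p c) (cno p' c') = ⊥-elim (p' p)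
count-unique (cno p c) (cyes p' c') = ⊥-elim (p p')
count-unique (cno p c) (cno p' c') = count-unique c c'

count-prefix : ∀ {P : ℕ → Set} {n k m} → m ≤ n → CountUpTo P n k → Σ ℕ λ k' → (k' ≤ k) × CountUpTo P m k'
count-prefix h c with m≤n⇒m<n∨m≡n h
count-prefix h c | inj₂ refl = _ , ≤-refl , c
count-prefix h c0 | inj₁ ()
count-prefix h (cyes p c) | inj₁ lt with count-prefix (≤-pred lt) c
... | k' , le , c' = k' , m≤n⇒m≤1+n le , c'
count-prefix h (cno p c) | inj₁ lt = count-prefix (≤-pred lt) c

count-< : ∀ {P : ℕ → Set} {m l y k} → P y → m < y → CountUpTo P m l → CountUpTo P y k → l < k
count-< py lt c (cno p d) = ⊥-elim (p py)
count-< py lt c (cyes p d) with count-prefix (≤-pred lt) d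
... | k' , le , d' with count-unique c d'
... | refl = s≤s le

Root : Tree → ℕ → Set
Root T y = (1 ≤ y) × (y ≤ size T) × (∀ x → x < y → ¬ InR T x y)

DecRoot⇔Root : ∀ {T₁ T₂ y} → (DecRoot (iposT T₁ T₂) y → Root T₁ y) × (Root T₁ y → DecRoot (iposT T₁ T₂) y)
DecRoot⇔Root = (λ (h , h' , f) → h , h' , λ x lt p → f x lt (dec p))
  , λ (h , h' , f) → h , h' , λ { x lt (eqv _ _) → <-irrefl refl lt
                                ; x lt (inc p) → <-asym lt (InL-< p)
                                ; x lt (dec p) → f x lt p }

-- `A` sits at the end of the left branch of `B`, so no node of `B` has a node of `A` in its right
-- subtree.
Root-⊕ˡ : ∀ A B {y} → y ≤ size A → (Root A y → Root (A ⊕ B) y) × (Root (A ⊕ B) y → Root A y)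
Root-⊕ˡ A B {y} hy =
    (λ (h , h' , f) → h , ≤-trans h' (≤-trans (m≤m+n _ _) (≤-reflexive (sym (size-⊕ A B)))) , λ x lt p → f x lt (inv p))
  , (λ (h , h' , f) → h , hy , λ x lt p → f x lt (InR-⊕ˡ B p))
  where
  inv : ∀ {x} → InR (A ⊕ B) x y → InR A x y
  inv p with InR-⊕⁻¹ A B p
  ... | inj₁ q = q
  ... | inj₂ (_ , zero , _ , _ , q) = ⊥-elim (n≮0 (InR-< q))
  ... | inj₂ (_ , suc _ , _ , refl , _) = ⊥-elim (m+1+n≰m (size A) hy)

Root-node : ∀ L R → Root (node L R) (suc (size L))
Root-node L R = s≤s z≤n , s≤s (m≤m+n _ _) ,
  λ x lt p → 1+n≰n (InR-size (InR-left⁻¹ p (≤-pred lt)))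

count-roots : ∀ T → CountUpTo (Root T) (size T) (roots T)
count-roots leaf = c0
count-roots (node L R) = non-roots (size R) ≤-refl
  where
  non-roots : ∀ j → j ≤ size R → CountUpTo (Root (node L R)) (suc (size L + j)) (suc (roots L))
  non-roots zero h rewrite +-identityʳ (size L) =
    -- `node L R` computes from `L ⊕ node leaf R`, so the labels before the root count as in `L`.
    -- The labels after it lie in its right subtree and are not roots.
    cyes (Root-node L R) (count-map (λ _ h → Root-⊕ˡ L (node leaf R) h) (count-roots L))
  non-roots (suc j) h rewrite +-suc (size L) j =
    cno (λ (_ , _ , f) → f (suc (size L)) (s≤s (s≤s (m≤m+n _ _)))
          (here (s≤s (s≤s (m≤m+n _ _))) (s≤s (≤-trans (≤-reflexive (sym (+-suc (size L) j))) (+-monoʳ-≤ (size L) h)))))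
        (non-roots j (<⇒≤ h))

count-roots-⊕ : ∀ A B C → CountUpTo (DecRoot (iposT (A ⊕ B) C)) (size A) (roots A)
count-roots-⊕ A B C = count-map
  (λ _ h → (λ r → proj₂ DecRoot⇔Root (proj₁ (Root-⊕ˡ A B h) r)) , (λ r → proj₂ (Root-⊕ˡ A B h) (proj₁ DecRoot⇔Root r)))
  (count-roots A)

root-above : ∀ T {y} → 1 ≤ y → y ≤ size T → Σ ℕ λ r → Root T r × ((r ≡ y) ⊎ InR T r y)
root-above leaf (s≤s h) ()
root-above (node L R) {y} h h' with <-cmp y (suc (size L))
... | tri< lt _ _ with root-above L h (≤-pred lt)
...   | r , rt , inj₁ refl = r , proj₁ (Root-⊕ˡ L (node leaf R) (≤-pred lt)) rt , inj₁ refl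
...   | r , rt , inj₂ p = r , proj₁ (Root-⊕ˡ L (node leaf R) (proj₁ (proj₂ rt))) rt , inj₂ (left p)
root-above (node L R) h h' | tri≈ _ refl _ = _ , Root-node L R , inj₁ refl
root-above (node L R) h h' | tri> _ _ gt = suc (size L) , Root-node L R , inj₂ (here gt h')

-- Graftings

tc-map : ∀ {R S : Rel₂} → (∀ {a b} → R a b → S a b) → ∀ {a b} → TransClosure R a b → TransClosure S a b
tc-map f [ p ]⁺ = [ f p ]⁺
tc-map f (p ∷ q) = f p ∷ tc-map f q

tc-fold : ∀ {R S : Rel₂} → (∀ {a b} → R a b → S a b) → (∀ {a b c} → S a b → S b c → S a c) →
  ∀ {a b} → TransClosure R a b → S a b
tc-fold f t [ p ]⁺ = f p
tc-fold f t (p ∷ q) = t (f p) (tc-fold f t q)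

leftGraft-cong : ∀ {P P' Q Q'} → P ≋ P' → Q ≋ Q' → leftGraft P Q ≋ leftGraft P' Q'
leftGraft-cong {record { sz = zero }} {record { sz = .zero }} (refl , f) eq = eq
leftGraft-cong {P@record { sz = suc n }} {P'@record { sz = .(suc n) }} {Q} {Q'} e@(refl , f) eq@(s , g) =
  cong (suc n +_) s , λ i j → tc-map (to {P} {P'} {Q} {Q'} e eq)
                            , tc-map (to {P'} {P} {Q'} {Q} (≋-sym e) (≋-sym eq))
  where
  to : ∀ {P P' Q Q'} → P ≋ P' → Q ≋ Q' → ∀ {a b} →
    concatRel P Q a b ⊎ (1 ≤ a × a ≤ sz P × b ≡ suc (sz P)) →
    concatRel P' Q' a b ⊎ (1 ≤ a × a ≤ sz P' × b ≡ suc (sz P'))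
  to (s , f) (t , g) (inj₁ (inj₁ (h , h' , r))) rewrite s = inj₁ (inj₁ (h , h' , proj₁ (f _ _) r))
  to (s , f) (t , g) (inj₁ (inj₂ (c , d , x , y , r))) rewrite s = inj₁ (inj₂ (c , d , x , y , proj₁ (g _ _) r))
  to (s , f) (t , g) (inj₂ x) rewrite s = inj₂ x

DecRoot-cong : ∀ {P Q} → P ≋ Q → ∀ {y} → DecRoot P y → DecRoot Q y
DecRoot-cong (s , f) (h , h' , g) = h , ≤-trans h' (≤-reflexive s) , λ x lt r → g x lt (proj₂ (f _ _) r)

rightGraft-cong : ∀ {Q Q'} P l → Q ≋ Q' → rightGraft P l Q ≋ rightGraft P l Q'
rightGraft-cong {Q} {Q'} P l e@(s , _) = cong (sz P +_) s , λ i j → tc-map (to {Q} {Q'} e) , tc-map (to {Q'} {Q} (≋-sym e))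
  where
  to : ∀ {Q Q'} → Q ≋ Q' → ∀ {a b} →
    concatRel P Q a b ⊎ Σ ℕ (λ y → Σ ℕ (λ k → (a ≡ sz P + y) × (b ≡ sz P) × DecRoot Q y × CountUpTo (DecRoot Q) y k × (k ≤ l))) →
    concatRel P Q' a b ⊎ Σ ℕ (λ y → Σ ℕ (λ k → (a ≡ sz P + y) × (b ≡ sz P) × DecRoot Q' y × CountUpTo (DecRoot Q') y k × (k ≤ l)))
  to (s , g) (inj₁ (inj₁ x)) = inj₁ (inj₁ x)
  to (s , g) (inj₁ (inj₂ (c , d , x , y , r))) = inj₁ (inj₂ (c , d , x , y , proj₁ (g _ _) r))
  to {Q} {Q'} e (inj₂ (y , k , x , x' , r , c , h)) = inj₂ (y , k , x , x' , DecRoot-cong {Q} {Q'} e r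
    , count-map (λ _ _ → DecRoot-cong {Q} {Q'} e , DecRoot-cong {Q'} {Q} (≋-sym e)) c , h)

-- The added generators are the `here` relations of the root of the upper tree. By transitivity of
-- the pair the closure stays inside its relations; conversely, each of these is a single generator.
leftGraft-iposT : ∀ {A₁ A₂ C₁ B₂} → size A₁ ≡ size A₂ → (A₁ ⊕ C₁) ≤T node A₂ B₂ →
  leftGraft (iposT A₁ A₂) (iposT C₁ (node leaf B₂)) ≋ iposT (A₁ ⊕ C₁) (node A₂ B₂)
leftGraft-iposT {leaf} {leaf} {C₁} s le rewrite ⊕-identityˡ C₁ = refl , λ i j → (λ r → r) , (λ r → r)
leftGraft-iposT {A₁@(node X Y)} {A₂} {C₁} {B₂} s le = sym (size-⊕ A₁ C₁) , λ i j → tc-fold to (iposT-trans le) , λ r → [ from r ]⁺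
  where
  n = size A₁
  Gen : Rel₂
  Gen a b = concatRel (iposT A₁ A₂) (iposT C₁ (node leaf B₂)) a b ⊎ (1 ≤ a × a ≤ n × b ≡ suc n)
  size≤ : ∀ {a} → a ≤ n → a ≤ size (A₁ ⊕ C₁)
  size≤ h = ≤-trans h (≤-trans (m≤m+n _ _) (≤-reflexive (sym (size-⊕ A₁ C₁))))
  shift : ∀ a → n + suc a ≡ suc (size A₂) + a
  shift a = trans (+-suc n a) (cong (λ m → suc m + a) s)
  to : ∀ {a b} → Gen a b → rel (iposT (A₁ ⊕ C₁) (node A₂ B₂)) a b
  to (inj₁ (inj₁ (_ , _ , eqv h h'))) = eqv h (size≤ h')
  to (inj₁ (inj₁ (_ , _ , inc p))) = inc (left p)
  to (inj₁ (inj₁ (_ , _ , dec p))) = dec (InR-⊕ˡ C₁ p)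
  to (inj₁ (inj₂ (c , d , refl , refl , eqv h h'))) =
    eqv (s≤s z≤n) (≤-trans (+-monoʳ-≤ n h') (≤-reflexive (sym (size-⊕ A₁ C₁))))
  to (inj₁ (inj₂ (c , d , refl , refl , inc (here h h')))) = ⊥-elim (1+n≰n (≤-trans h h'))
  to (inj₁ (inj₂ (c , d , refl , refl , inc (right p)))) = inc (rightL (shift _) (shift _) p)
  to (inj₁ (inj₂ (c , d , refl , refl , dec p))) = dec (InR-⊕ʳ A₁ C₁ p)
  to (inj₂ (h , h' , refl)) = inc (hereL (cong suc s) h (subst (_ ≤_) s h'))
  from : ∀ {a b} → rel (iposT (A₁ ⊕ C₁) (node A₂ B₂)) a b → Gen a b
  from {a} (eqv h h') with a ≤? n
  ... | yes le = inj₁ (inj₁ (le , le , eqv h le))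
  ... | no nle with m≤n⇒∃[o]m+o≡n (<⇒≤ (≰⇒> nle))
  ...   | o , refl = inj₁ (inj₂ (o , o , refl , refl
            , eqv (+-cancelˡ-≤ n 1 o (≤-trans (≤-reflexive (+-comm n 1)) (≰⇒> nle)))
                  (+-cancelˡ-≤ n _ _ (≤-trans h' (≤-reflexive (size-⊕ A₁ C₁))))))
  from (inc (here h h')) = inj₂ (h , subst (_ ≤_) (sym s) h' , cong suc (sym s))
  from (inc (left p)) with InL-bounds p
  ... | _ , l , h rewrite sym s = inj₁ (inj₁ (≤-trans (<⇒≤ l) h , h , inc p))
  from (inc (right p)) = inj₁ (inj₂ (_ , _ , sym (shift _) , sym (shift _) , inc (right p)))
  from (dec p) with InR-⊕⁻¹ A₁ C₁ p
  ... | inj₁ q = inj₁ (inj₁ (InR-size q , ≤-trans (<⇒≤ (InR-< q)) (InR-size q) , dec q))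
  ... | inj₂ (a' , b' , e , e' , q) = inj₁ (inj₂ (b' , a' , e' , e , dec q))

rightGraft-iposT : ∀ X Y B → (node leaf X ⊕ Y) ≤T node leaf B →
  rightGraft uP (roots X) (iposT (X ⊕ Y) B) ≋ iposT (node leaf X ⊕ Y) (node leaf B)
rightGraft-iposT X Y B le = sizes , λ i j → tc-fold to (iposT-trans le) , from
  where
  sizes : suc (size (X ⊕ Y)) ≡ size (node leaf X ⊕ Y)
  sizes = trans (cong suc (size-⊕ X Y)) (sym (size-⊕ (node leaf X) Y))
  Gen : Rel₂
  Gen a b = concatRel uP (iposT (X ⊕ Y) B) a b
    ⊎ Σ ℕ (λ y → Σ ℕ (λ k → (a ≡ 1 + y) × (b ≡ 1) × DecRoot (iposT (X ⊕ Y) B) y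
             × CountUpTo (DecRoot (iposT (X ⊕ Y) B)) y k × (k ≤ roots X)))
  InR-suc : ∀ {a b} → InR (X ⊕ Y) a b → InR (node leaf X ⊕ Y) (suc a) (suc b)
  InR-suc p with InR-⊕⁻¹ X Y p
  ... | inj₁ q = InR-⊕ˡ Y (right q)
  ... | inj₂ (a' , b' , refl , refl , q) = InR-⊕ʳ (node leaf X) Y q
  to : ∀ {a b} → Gen a b → rel (iposT (node leaf X ⊕ Y) (node leaf B)) a b
  to (inj₁ (inj₁ (_ , _ , refl , refl))) = eqv (s≤s z≤n) (≤-trans (s≤s z≤n) (≤-reflexive sizes))
  to (inj₁ (inj₂ (c , d , refl , refl , eqv h h'))) = eqv (s≤s z≤n) (≤-trans (s≤s h') (≤-reflexive sizes))
  to (inj₁ (inj₂ (c , d , refl , refl , inc p))) = inc (right p)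
  to (inj₁ (inj₂ (c , d , refl , refl , dec p))) = dec (InR-suc p)
  to (inj₂ (y , k , refl , refl , r , c , h)) with y ≤? size X
  ... | yes h' = dec (InR-⊕ˡ Y (here (s≤s (proj₁ r)) (s≤s h')))
  -- The count up to `size X` is already `roots X`, so a root beyond `X` has a higher rank than the
  -- graft allows.
  ... | no h' = ⊥-elim (<⇒≱ (count-< r (≰⇒> h') (count-roots-⊕ X Y B) c) h)
  shifted : ∀ {c d} → rel (iposT (X ⊕ Y) B) c d → Gen (suc c) (suc d)
  shifted r = inj₁ (inj₂ (_ , _ , refl , refl , r))
  below : ∀ {y} → Root X y → Gen (suc y) 1
  below (h , h' , f) with count-prefix h' (count-roots-⊕ X Y B)
  ... | k , kl , c = inj₂ (_ , k , refl , refl , proj₂ DecRoot⇔Root (proj₁ (Root-⊕ˡ X Y h') (h , h' , f)) , c , kl)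
  from : ∀ {a b} → rel (iposT (node leaf X ⊕ Y) (node leaf B)) a b → TransClosure Gen a b
  from {suc zero} (eqv h h') = [ inj₁ (inj₁ (≤-refl , ≤-refl , refl , refl)) ]⁺
  from {suc (suc a)} (eqv h h') = [ shifted (eqv (s≤s z≤n) (≤-pred (≤-trans h' (≤-reflexive (sym sizes))))) ]⁺
  from (inc (here h h')) = ⊥-elim (1+n≰n (≤-trans h h'))
  from (inc (right p)) = [ shifted (inc p) ]⁺
  from (dec p) with InR-⊕⁻¹ (node leaf X) Y p
  ... | inj₂ (a' , b' , refl , refl , q) = [ shifted (dec (InR-⊕ʳ X Y q)) ]⁺
  ... | inj₁ (right q) = [ shifted (dec (InR-⊕ˡ Y q)) ]⁺
  ... | inj₁ (here (s≤s h) (s≤s h')) with root-above X h h'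
  ...   | r , rt , inj₁ refl = [ below rt ]⁺
  -- Right grafting links only roots to 1; any other label of `X` reaches 1 through the root above
  -- it, so here the closure is needed.
  ...   | r , rt , inj₂ q = shifted (dec (InR-⊕ˡ Y q)) ∷ [ below rt ]⁺

hang-≤T : ∀ A k B {A' B'} → k ≤ roots B → A ≤T A' → B ≤T B' → hang A k B ≤T node A' B'
hang-≤T A k B h p q = Chain⇒≤T (hang-Chain A k B h) ◅◅ node-mono p q

-- Right grafting onto `u` produces `hang leaf`, left grafting puts the lower left tree in front,
-- and `hang-⊕` merges the two into the clause of `lowerTree`.
graftInv-iposT : ∀ G → Valid G → graftInv G ≋ iposT (lowerTree G) (upperTree G)
graftInv-iposT gleaf v = refl , λ i j → (λ ()) , λ { (eqv (s≤s h) ()) ; (inc ()) ; (dec ()) }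
graftInv-iposT (gnode L l R) (vL , vR , h) =
  ≋-trans (leftGraft-cong (graftInv-iposT L vL) (≋-trans (rightGraft-cong uP l (graftInv-iposT R vR)) right-part))
    (subst (λ T → leftGraft (iposT L₁ L₂) (iposT (hang leaf k R₁) (node leaf R₂)) ≋ iposT T (node L₂ R₂))
      (sym (hang-⊕ L₁ k R₁))
      (leftGraft-iposT (trans (size-lowerTree L) (sym (size-upperTree L)))
        (subst (_≤T node L₂ R₂) (hang-⊕ L₁ k R₁) (hang-≤T L₁ k R₁ k≤ (graft-≤T L vL) (graft-≤T R vR)))))
  where
  L₁ = lowerTree L ; L₂ = upperTree L ; R₁ = lowerTree R ; R₂ = upperTree R
  k = slack l R
  k≤ = slack≤roots R l vR h
  right-part : rightGraft uP l (iposT R₁ R₂) ≋ iposT (hang leaf k R₁) (node leaf R₂)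
  right-part with hang-split k R₁ k≤ | hang-≤T leaf k R₁ k≤ ε (graft-≤T R vR)
  -- The graft parameter is the label: `roots X` and `l` both complete the slack `k` to the number
  -- of roots of `R₁`.
  ... | X , Y , e , r , hang≡ | le = subst₂ (λ T m → rightGraft uP m (iposT T R₂) ≋ iposT (hang leaf k R₁) (node leaf R₂))
    (sym e) (+-cancelʳ-≡ k _ _ (trans r (trans (sym (slack-label R l vR h)) (+-comm k l))))
    (subst (λ T → rightGraft uP (roots X) (iposT (X ⊕ Y) R₂) ≋ iposT T (node leaf R₂)) (sym (hang≡ leaf))
      (rightGraft-iposT X Y R₂ (subst (_≤T node leaf R₂) (hang≡ leaf) le)))

-- The map β

Represents : Tree → Tree → GTree → Set
Represents T₁ T₂ G = (T₁ ≡ lowerTree G) × (T₂ ≡ upperTree G)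

-- `ipos I` unfolds to `iposT (lower I) (upper I)`, so an equivalence of posets yields equalities of
-- trees.
represents : ∀ {G} (I : Interval) → Valid G → ipos I ≋ graftInv G → Represents (lower I) (upper I) G
represents {G} I v e = iposT-injective (size-≤T (le I)) (trans (size-lowerTree G) (sym (size-upperTree G)))
  (≋-trans e (graftInv-iposT G v))

compl-graftInv : ∀ G → Valid G → compl (graftInv G) ≋ iposT (mirror (upperTree G)) (mirror (lowerTree G))
compl-graftInv G v = ≋-trans (compl-cong (graftInv-iposT G v))
  (compl-iposT (trans (size-lowerTree G) (sym (size-upperTree G))))

compl-represents : ∀ {G H} → Valid G → Valid H → graftInv G ≋ compl (graftInv H) →
  Represents (mirror (upperTree H)) (mirror (lowerTree H)) G
compl-represents {G} {H} v w e = iposT-injective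
  (trans (size-mirror (upperTree H)) (trans (size-upperTree H) (trans (sym (size-lowerTree H)) (sym (size-mirror (lowerTree H))))))
  (trans (size-lowerTree G) (sym (size-upperTree G)))
  (≋-trans (≋-sym (compl-graftInv H w)) (≋-trans (≋-sym e) (graftInv-iposT G v)))

compl-graftInv-sym : ∀ G H → Valid G → Valid H → graftInv G ≋ compl (graftInv H) → graftInv H ≋ compl (graftInv G)
compl-graftInv-sym G H v w e with compl-represents {G} {H} v w e
... | p , q = ≋-trans (graftInv-iposT H w) (≋-sym (subst₂ (λ S T → compl (graftInv G) ≋ iposT S T)
  (trans (cong mirror (sym q)) (mirror-involutive (lowerTree H)))
  (trans (cong mirror (sym p)) (mirror-involutive (upperTree H)))
  (compl-graftInv G v)))

intervalOf : ∀ G → Valid G → Interval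
intervalOf G v = interval (lowerTree G) (upperTree G) (graft-≤T G v)

-- The mirrored pair is an interval because mirroring reverses the order; its grafting tree is the
-- witness `G'`.
β-exists : (I : Interval) → Σ Interval (BetaRel I)
β-exists I with grafting (le I)
... | graft G v refl refl with grafting (mirror-≤T (graft-≤T (LB G) (Valid-LB G v)))
... | graft G' v' l' u' = intervalOf (LB G') (Valid-LB G' v')
  , G , G' , v , v' , ≋-sym (graftInv-iposT G v)
  , ≋-trans (subst₂ (λ S T → graftInv G' ≋ iposT S T) l' u' (graftInv-iposT G' v'))
      (≋-sym (compl-graftInv (LB G) (Valid-LB G v)))
  , ≋-sym (graftInv-iposT (LB G') (Valid-LB G' v'))

-- The two derivations may choose their own witnesses. Posets determine pairs and pairs determine
-- grafting trees, so the choices coincide at each stage.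
β-unique : (I J J' : Interval) → BetaRel I J → BetaRel I J' → (lower J ≡ lower J') × (upper J ≡ upper J')
β-unique I J J' (G , G₁ , v , v₁ , eI , e , eJ) (H , H₁ , w , w₁ , eI' , e' , eJ')
  with represents I v eI | represents I w eI'
... | p , q | p' , q' with gtree-unique G H v w (trans (sym p) p') (trans (sym q) q')
... | refl with compl-represents {G₁} {LB G} v₁ (Valid-LB G v) e | compl-represents {H₁} {LB G} w₁ (Valid-LB G v) e'
... | a , b | a' , b' with gtree-unique G₁ H₁ v₁ w₁ (trans (sym a) a') (trans (sym b) b')
... | refl with represents J (Valid-LB G₁ v₁) eJ | represents J' (Valid-LB G₁ v₁) eJ'
... | c , d | c' , d' = trans c (sym c') , trans d (sym d')

-- All three factors of β are involutions, so the derivation can be read backwards, with `LB G'` and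
-- `LB G` as witnesses.
β-sym : (I J : Interval) → BetaRel I J → BetaRel J I
β-sym I J (G , G' , v , v' , eI , e , eJ) =
  LB G' , LB G , Valid-LB G' v' , Valid-LB G v , eJ
  , subst (λ H → graftInv (LB G) ≋ compl (graftInv H)) (sym (LB-involutive G'))
      (compl-graftInv-sym G' (LB G) v' (Valid-LB G v) e)
  , subst (λ H → ipos I ≋ graftInv H) (sym (LB-involutive G)) eI

theorem4p24 : (I : Interval) →
    Σ Interval (λ J → BetaRel I J)
    × (∀ J J' → BetaRel I J → BetaRel I J' →
    (lower J ≡ lower J') × (upper J ≡ upper J'))
    × (∀ J → BetaRel I J →
    BetaRel J I
    × (rises (dyck (upper I)) ≡ contacts (dyck (lower J)))
    × ((M : CommutativeMonoid 0ℓ 0ℓ) (x : ℕ → CommutativeMonoid.Carrier M) →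
    CommutativeMonoid._≈_ M (RiseMon M x (dyck (upper I)))
    (ContactMon M x (dyck (lower J))))
    × Σ ℕ (λ d → IsDist (lower I) (upper I) d × IsDist (lower J) (upper J) d))
theorem4p24 I = β-exists I , β-unique I , λ J r → β-sym I J r , statistics J r
  where
  statistics : ∀ J → BetaRel I J →
    (rises (dyck (upper I)) ≡ contacts (dyck (lower J)))
    × ((M : CommutativeMonoid 0ℓ 0ℓ) (x : ℕ → CommutativeMonoid.Carrier M) →
    CommutativeMonoid._≈_ M (RiseMon M x (dyck (upper I))) (ContactMon M x (dyck (lower J))))
    × Σ ℕ (λ d → IsDist (lower I) (upper I) d × IsDist (lower J) (upper J) d)
  statistics J (G , G' , v , v' , eI , e , eJ)
    with represents I v eI | represents J (Valid-LB G' v') eJ | compl-represents {G'} {LB G} v' (Valid-LB G v) e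
  ... | p , q | p' , q' | a , b rewrite p | q | p' | q' =
    rises≡contacts G G' v' (sym a) , RiseMon≈ContactMon G G' v' (sym a)
    , totalSlack G , dist-graft G v
    , subst (IsDist (lowerTree (LB G')) (upperTree (LB G'))) slacks (dist-graft (LB G') (Valid-LB G' v'))
    where
    slacks : totalSlack (LB G') ≡ totalSlack G
    -- `G'` and `LB G` are never compared as grafting trees: their slacks are the distances of two
    -- mirrored intervals, hence equal.
    slacks = trans (totalSlack-LB G') (trans
      (IsDist-unique (dist-graft G' v')
        (subst₂ (λ S T → IsDist S T (totalSlack (LB G))) a b (IsDist-mirror (dist-graft (LB G) (Valid-LB G v)))))
      (totalSlack-LB G))
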